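{- Let $\mathbb{D}=(D,\mathcal{X})$ be a linear space such that there is an integer $q\ge 3$ with $|D|=q^2$, $|\mathcal{X}_p|\le q+1$ for each $p\in D$, and $|D_X|\le q+1$ for each $X\in\mathcal{X}$. Then $\mathbb{D}$ is obtained by deleting $q+1$ points from a projective plane of order $q$. Explicitly, one of the following cases occurs: (a) There is no line $X\in\mathcal{X}$ with $|D_X|=q+1$, and $\mathbb{D}$ is an affine plane of order $q$, with $|\mathcal{X}|=q^2+q$. (b) There exists a point $u\in D$ with $|\mathcal{X}_u|\le q$, and $\mathbb{D}$ is obtained from a projective plane $\mathbb{P}=(P,\mathcal{L})$ of order $q$ by deleting some line $W$ from $\mathcal{L}$ and deleting the point set $(P_W\setminus\{u\})\cup\{v\}$ from $P$, where $u$ is some point on $W$ and $v$ is some point of $P\setminus P_W$ (the lines of $\mathbb{D}$ being the lines of $\mathbb{P}$ other than $W$, with induced incidence); moreover $|\mathcal{X}|=q^2+q$, $|\mathcal{X}_u|=q$, and $|\mathcal{X}_p|=q+1$ for each $p\in D\setminus\{u\}$. (c) We have $|\mathcal{X}|=q^2+q+1$ and $|\mathcal{X}_p|=q+1$ for each $p\in D$. In this case $\mathbb{D}$ is obtained from a projective plane $\mathbb{P}=(P,\mathcal{L})$ of order $q$ by deleting a set $Y$ of $q+1$ points such that no $q$ of them are collinear (with $\mathcal{X}=\mathcal{L}$ and induced incidence), and for each $y\in Y$ there exists a line $X_y\in\mathcal{L}$ through $y$ such that $|D_{X_y}|=q$.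
   Context: A linear space is an incidence geometry $(D,\mathcal{X},I)$ with point set $D$, line set $\mathcal{X}$ and incidence relation $I\subseteq D\times\mathcal{X}$ such that any two distinct points are incident with exactly one common line, and each line is incident with at least two points. For $p\in D$, $\mathcal{X}_p$ is the set of lines incident with $p$; for a line $X$, $D_X$ is the set of points of $D$ incident with $X$ (for a projective plane $\mathbb{P}=(P,\mathcal{L})$ and a line $W$, $P_W$ is the set of points of $\mathbb{P}$ on $W$). "Obtained by deleting points from a projective plane" means: the points of $\mathbb{D}$ are the remaining points, the lines of $\mathbb{D}$ are (identified with) lines of the plane containing at least two remaining points, and incidence is the induced one. -}

module Defs where

open import Data.Nat using (ℕ; zero; suc; _+_; _*_; _≤_; _<_)
open import Data.Bool using (Bool; true; false; _∧_)
open import Data.Fin using (Fin)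
open import Data.Fin.Subset using (Subset; ∣_∣)
open import Data.Vec using (tabulate)
open import Data.Product using (Σ; _×_; _,_)
open import Data.Sum using (_⊎_)
open import Relation.Binary.PropositionalEquality using (_≡_; _≢_)
open import Relation.Nullary using (¬_)

-- A finite incidence structure: points Fin n, lines Fin m, and a Boolean
-- incidence relation  I p X ≡ true  iff point p is incident with line X.
Incidence : ℕ → ℕ → Set
Incidence n m = Fin n → Fin m → Bool

module _ {n m : ℕ} (I : Incidence n m) where

  linesThrough : Fin n → ℕ
  linesThrough p = ∣ tabulate (λ X → I p X) ∣

  pointsOn : Fin m → ℕ
  pointsOn X = ∣ tabulate (λ p → I p X) ∣

  TwoPointsOneLine : Set
  TwoPointsOneLine = (p p' : Fin n) → p ≢ p' →
    Σ (Fin m) λ X → (I p X ≡ true × I p' X ≡ true) ×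
      ((X' : Fin m) → I p X' ≡ true → I p' X' ≡ true → X' ≡ X)

  TwoLinesOnePoint : Set
  TwoLinesOnePoint = (X X' : Fin m) → X ≢ X' →
    Σ (Fin n) λ p → (I p X ≡ true × I p X' ≡ true) ×
      ((p' : Fin n) → I p' X ≡ true → I p' X' ≡ true → p' ≡ p)

  Collinear3 : Fin n → Fin n → Fin n → Set
  Collinear3 a b c = Σ (Fin m) λ X → I a X ≡ true × I b X ≡ true × I c X ≡ true

  record IsLinearSpace : Set where
    field
      twoPoints : TwoPointsOneLine
      lineHasTwoPoints : (X : Fin m) →
        Σ (Fin n) λ p → Σ (Fin n) λ p' → p ≢ p' × I p X ≡ true × I p' X ≡ true

  record IsProjectivePlaneOfOrder (q : ℕ) : Set where
    field
      twoPoints : TwoPointsOneLine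
      twoLines  : TwoLinesOnePoint
      quadrangle : Σ (Fin n) λ a → Σ (Fin n) λ b → Σ (Fin n) λ c → Σ (Fin n) λ d →
        (a ≢ b × a ≢ c × a ≢ d × b ≢ c × b ≢ d × c ≢ d) ×
        (¬ Collinear3 a b c × ¬ Collinear3 a b d × ¬ Collinear3 a c d × ¬ Collinear3 b c d)
      order : (X : Fin m) → pointsOn X ≡ suc q

  record IsAffinePlaneOfOrder (q : ℕ) : Set where
    field
      twoPoints : TwoPointsOneLine
      parallel : (p : Fin n) (X : Fin m) → I p X ≡ false →
        Σ (Fin m) λ Y → (I p Y ≡ true × ((r : Fin n) → I r X ≡ true → I r Y ≡ false)) ×
          ((Y' : Fin m) → I p Y' ≡ true → ((r : Fin n) → I r X ≡ true → I r Y' ≡ false) → Y' ≡ Y)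
      triangle : Σ (Fin n) λ a → Σ (Fin n) λ b → Σ (Fin n) λ c →
        (a ≢ b × a ≢ c × b ≢ c) × ¬ Collinear3 a b c
      order : (X : Fin m) → pointsOn X ≡ q

-- The linear space (Fin n, Fin m, I) is obtained from the incidence structure
-- (Fin nP, Fin nL, J) by deleting the point set Y (as a subset, Y x ≡ true
-- means x is deleted): f identifies the points of D with the points outside Y,
-- g identifies the lines of D with the lines of P having at least two points
-- outside Y, and incidence is the induced one.
record ObtainedByDeleting {n m nP nL : ℕ} (I : Incidence n m) (J : Incidence nP nL)
                          (Y : Fin nP → Bool) : Set where
  field
    f : Fin n → Fin nP
    g : Fin m → Fin nL
    f-inj : (p p' : Fin n) → f p ≡ f p' → p ≡ p'
    g-inj : (X X' : Fin m) → g X ≡ g X' → X ≡ X'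
    f-notDeleted : (p : Fin n) → Y (f p) ≡ false
    f-onto : (x : Fin nP) → Y x ≡ false → Σ (Fin n) λ p → f p ≡ x
    g-twoRemaining : (X : Fin m) →
      Σ (Fin nP) λ x → Σ (Fin nP) λ x' → x ≢ x' ×
        (Y x ≡ false × Y x' ≡ false) × (J x (g X) ≡ true × J x' (g X) ≡ true)
    g-onto : (L : Fin nL) →
      (Σ (Fin nP) λ x → Σ (Fin nP) λ x' → x ≢ x' ×
        (Y x ≡ false × Y x' ≡ false) × (J x L ≡ true × J x' L ≡ true)) →
      Σ (Fin m) λ X → g X ≡ L
    incidence : (p : Fin n) (X : Fin m) → I p X ≡ J (f p) (g X)

card : {k : ℕ} → (Fin k → Bool) → ℕ
card Y = ∣ tabulate Y ∣

ObtainedFromProjectivePlane : {n m : ℕ} → Incidence n m → ℕ → Set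
ObtainedFromProjectivePlane {n} {m} I q =
  Σ ℕ λ nP → Σ ℕ λ nL → Σ (Incidence nP nL) λ J →
    IsProjectivePlaneOfOrder J q ×
    Σ (Fin nP → Bool) λ Y → card Y ≡ suc q × ObtainedByDeleting I J Y

module _ {n m : ℕ} (I : Incidence n m) (q : ℕ) where

  CaseA : Set
  CaseA = ((X : Fin m) → ¬ (pointsOn I X ≡ suc q)) ×
          IsAffinePlaneOfOrder I q × m ≡ q * q + q

  CaseB : Set
  CaseB = Σ (Fin n) λ u → linesThrough I u ≤ q ×
    (Σ ℕ λ nP → Σ ℕ λ nL → Σ (Incidence nP nL) λ J →
      IsProjectivePlaneOfOrder J q ×
      Σ (Fin nL) λ W → Σ (Fin nP) λ u' → Σ (Fin nP) λ v →
        J u' W ≡ true × J v W ≡ false ×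
        Σ (Fin nP → Bool) λ Y →
          ((x : Fin nP) → Y x ≡ true → (J x W ≡ true × x ≢ u') ⊎ x ≡ v) ×
          ((x : Fin nP) → J x W ≡ true → x ≢ u' → Y x ≡ true) × Y v ≡ true ×
          Σ (ObtainedByDeleting I J Y) λ R →
            ObtainedByDeleting.f R u ≡ u' ×
            ((X : Fin m) → ObtainedByDeleting.g R X ≢ W) ×
            ((L : Fin nL) → L ≢ W → Σ (Fin m) λ X → ObtainedByDeleting.g R X ≡ L)) ×
    m ≡ q * q + q × linesThrough I u ≡ q ×
    ((p : Fin n) → p ≢ u → linesThrough I p ≡ suc q)

  CaseC : Set
  CaseC = m ≡ q * q + q + 1 × ((p : Fin n) → linesThrough I p ≡ suc q) ×
    (Σ ℕ λ nP → Σ ℕ λ nL → Σ (Incidence nP nL) λ J →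
      IsProjectivePlaneOfOrder J q ×
      Σ (Fin nP → Bool) λ Y → card Y ≡ suc q ×
        ((L : Fin nL) → card (λ x → Y x ∧ J x L) < q) ×
        Σ (ObtainedByDeleting I J Y) λ R →
          ((L : Fin nL) → Σ (Fin m) λ X → ObtainedByDeleting.g R X ≡ L) ×
          ((y : Fin nP) → Y y ≡ true →
            Σ (Fin m) λ X → J y (ObtainedByDeleting.g R X) ≡ true × pointsOn I X ≡ q))

{-# OPTIONS --safe #-}

-- Suppose any two points are on one line, every point is on q + 1 lines, and there are q² + q + 1
-- lines but only n < q² + q + 1 points, n ≥ q². Lines with fewer than two points are allowed.
-- Computing ∑ k and ∑ k² over the line sizes k gives ∑ (k - q)² < q² + q + 1, hence some line X has
-- exactly q points. Through each point off X there is then just one line missing X, so X and the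
-- lines missing it partition the points, and a new point can be adjoined to them without losing the
-- hypotheses. At n = q² + q + 1 the same sums give ∑ (k - q - 1)² = 0, and one has a projective plane.
--
-- A point of a linear space as in the theorem is on q or q + 1 lines, and at most one point u is on
-- only q. If u exists, adjoining {u} as a line makes the space satisfy the above hypotheses (case b).
-- Otherwise the space satisfies them already if some line has q + 1 points (case c), and it does so
-- after adjoining an empty line if not (case a). When q + 1 is attained, the number of lines is
-- q² + q + 1 because all lines meet a line with q + 1 points.

module Submission where

open import Defs
open import Data.Bool using (Bool; true; false; _∧_; _∨_; not)
open import Data.Bool.Properties using (¬-not) renaming (_≟_ to _≟ᵇ_)
open import Data.Fin using (Fin; zero; suc; _≟_; _↑ʳ_; fromℕ<)
open import Data.Fin.Properties using (any?; suc-injective; ↑ʳ-injective)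
open import Data.Nat using (ℕ; zero; suc; pred; _+_; _*_; _≤_; _<_; z≤n; s≤s; _≤?_; >-nonZero)
open import Data.Nat.Properties hiding (suc-injective) renaming (_≟_ to _≟ℕ_)
open import Data.Nat.Tactic.RingSolver using (solve-∀)
open import Data.Product using (Σ; ∃; _×_; _,_; proj₁; proj₂; map₂)
open import Data.Sum using (_⊎_; inj₁; inj₂)
open import Function using (_∘_; id)
open import Relation.Binary using (tri<; tri≈; tri>)
open import Relation.Binary.PropositionalEquality
  using (_≡_; _≢_; _≗_; refl; sym; trans; cong; cong₂; subst; module ≡-Reasoning)
open import Relation.Nullary using (¬_; Dec; yes; no; does; contradiction)
open import Relation.Nullary.Decidable using (dec-true; dec-false; _×-dec_; ¬?)
open import Algebra.Properties.Semiring.Sum +-*-semiring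
  using (sum; sum-syntax; sum-cong-≗; ∑-distrib-+; ∑-comm; *-distribˡ-sum; *-distribʳ-sum)

-- Finite sums of natural numbers

sum-mono : ∀ {n} {f g : Fin n → ℕ} → (∀ i → f i ≤ g i) → sum f ≤ sum g
sum-mono {zero}  f≤g = z≤n
sum-mono {suc n} f≤g = +-mono-≤ (f≤g zero) (sum-mono (f≤g ∘ suc))

-- This drives the extremal counts: once termwise bounds add up to the exact total, none of them has
-- slack. The bound on the tail pins down the head, and induction does the rest.
sum-≡⇒≗ : ∀ {n} {f g : Fin n → ℕ} → (∀ i → f i ≤ g i) → sum f ≡ sum g → f ≗ g
sum-≡⇒≗ {suc n} {f} {g} f≤g eq = λ { zero → head ; (suc i) → sum-≡⇒≗ (f≤g ∘ suc) tail i }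
  where
  open ≤-Reasoning
  head : f zero ≡ g zero
  head = ≤-antisym (f≤g zero) (+-cancelʳ-≤ (sum (g ∘ suc)) _ _ (begin
    sum g                        ≡⟨ eq ⟨
    sum f                        ≤⟨ +-monoʳ-≤ (f zero) (sum-mono (f≤g ∘ suc)) ⟩
    f zero + sum (g ∘ suc)       ∎))
  tail : sum (f ∘ suc) ≡ sum (g ∘ suc)
  tail = +-cancelˡ-≡ (f zero) _ _ (trans eq (cong (_+ sum (g ∘ suc)) (sym head)))

term≤sum : ∀ {n} (f : Fin n → ℕ) i → f i ≤ sum f
term≤sum f zero    = m≤m+n _ _
term≤sum f (suc i) = ≤-trans (term≤sum (f ∘ suc) i) (m≤n+m _ _)

sum-const : ∀ n c → ∑[ i < n ] c ≡ n * c
sum-const zero    c = refl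
sum-const (suc n) c = cong (c +_) (sum-const n c)

-- Double counting: `A` plays the part of an incidence matrix, and both sides evaluate the same
-- bilinear form in `f` and `g`.
∑-swap-* : ∀ {m n} (f : Fin m → ℕ) (A : Fin n → Fin m → ℕ) (g : Fin n → ℕ) →
  ∑[ X < m ] (f X * ∑[ a < n ] (A a X * g a)) ≡ ∑[ a < n ] (g a * ∑[ X < m ] (f X * A a X))
∑-swap-* {m} {n} f A g = begin
  ∑[ X < m ] (f X * ∑[ a < n ] (A a X * g a))    ≡⟨ sum-cong-≗ (λ X → *-distribˡ-sum (f X) (λ a → A a X * g a)) ⟩
  ∑[ X < m ] ∑[ a < n ] (f X * (A a X * g a))    ≡⟨ ∑-comm (λ X a → f X * (A a X * g a)) ⟩
  ∑[ a < n ] ∑[ X < m ] (f X * (A a X * g a))    ≡⟨ sum-cong-≗ (λ a → sum-cong-≗ (λ X → move (f X) (A a X) (g a))) ⟩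
  ∑[ a < n ] ∑[ X < m ] (g a * (f X * A a X))    ≡⟨ sum-cong-≗ (λ a → *-distribˡ-sum (g a) (λ X → f X * A a X)) ⟨
  ∑[ a < n ] (g a * ∑[ X < m ] (f X * A a X))    ∎
  where
  open ≡-Reasoning
  move : ∀ x y z → x * (y * z) ≡ z * (x * y)
  move = solve-∀

∑-swap : ∀ {m n} (f : Fin m → ℕ) (A : Fin n → Fin m → ℕ) →
  ∑[ X < m ] (f X * ∑[ a < n ] A a X) ≡ ∑[ a < n ] ∑[ X < m ] (f X * A a X)
∑-swap {m} f A =
  trans (sum-cong-≗ (λ X → *-distribˡ-sum (f X) (λ a → A a X))) (∑-comm (λ X a → f X * A a X))

-- Indicators and counting

⟦_⟧ : Bool → ℕ
⟦ true ⟧  = 1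
⟦ false ⟧ = 0

⟦⟧-idem : ∀ b → ⟦ b ⟧ * ⟦ b ⟧ ≡ ⟦ b ⟧
⟦⟧-idem true  = refl
⟦⟧-idem false = refl

⟦⟧-∧ : ∀ a b → ⟦ a ∧ b ⟧ ≡ ⟦ a ⟧ * ⟦ b ⟧
⟦⟧-∧ true  b = sym (+-identityʳ _)
⟦⟧-∧ false b = refl

∧-true : ∀ {a b} → a ∧ b ≡ true → a ≡ true × b ≡ true
∧-true {true} {true} refl = refl , refl

true-∧ : ∀ {a b} → a ≡ true → b ≡ true → a ∧ b ≡ true
true-∧ refl refl = refl

not-true : ∀ {b} → not b ≡ true → b ≡ false
not-true {false} refl = refl

true≢false : ∀ {b} → b ≡ true → b ≢ false
true≢false refl ()

count : ∀ {n} → (Fin n → Bool) → ℕ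
count f = sum (⟦_⟧ ∘ f)

card≡count : ∀ {n} (f : Fin n → Bool) → card f ≡ count f
card≡count {zero}  f = refl
card≡count {suc n} f with f zero
... | true  = cong suc (card≡count (f ∘ suc))
... | false = card≡count (f ∘ suc)

δ : ∀ {n} → Fin n → Fin n → ℕ
δ i j = ⟦ does (i ≟ j) ⟧

δ-refl : ∀ {n} (i : Fin n) → δ i i ≡ 1
δ-refl i = cong ⟦_⟧ (dec-true (i ≟ i) refl)

δ-≢ : ∀ {n} {i j : Fin n} → i ≢ j → δ i j ≡ 0
δ-≢ {i = i} {j} i≢j = cong ⟦_⟧ (dec-false (i ≟ j) i≢j)

∑-δ-* : ∀ {n} (i : Fin n) (f : Fin n → ℕ) → ∑[ j < n ] (δ i j * f j) ≡ f i
∑-δ-* {suc n} zero    f = trans (cong₂ _+_ (+-identityʳ (f zero)) (trans (sum-const n 0) (*-zeroʳ n))) (+-identityʳ _)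
∑-δ-* {suc n} (suc i) f = ∑-δ-* i (f ∘ suc)

∑-δ : ∀ {n} (i : Fin n) → ∑[ j < n ] δ i j ≡ 1
∑-δ i = trans (sum-cong-≗ (λ j → sym (*-identityʳ (δ i j)))) (∑-δ-* i (λ _ → 1))

-- A row of the all-one matrix plus `q` times the identity, applied to a weight. Such rows describe
-- the joins of points and also govern the meets of lines.
∑-weighted-1+qδ : ∀ {n} q (i : Fin n) (w : Fin n → ℕ) →
  ∑[ j < n ] (w j * (1 + q * δ i j)) ≡ sum w + q * w i
∑-weighted-1+qδ {n} q i w = begin
  ∑[ j < n ] (w j * (1 + q * δ i j))        ≡⟨ sum-cong-≗ (λ j → expand q (w j) (δ i j)) ⟩
  ∑[ j < n ] (w j + q * (δ i j * w j))      ≡⟨ ∑-distrib-+ w (λ j → q * (δ i j * w j)) ⟩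
  sum w + ∑[ j < n ] (q * (δ i j * w j))    ≡⟨ cong (sum w +_) (*-distribˡ-sum q (λ j → δ i j * w j)) ⟨
  sum w + q * ∑[ j < n ] (δ i j * w j)      ≡⟨ cong (λ x → sum w + q * x) (∑-δ-* i w) ⟩
  sum w + q * w i                           ∎
  where
  open ≡-Reasoning
  expand : ∀ q w d → w * (1 + q * d) ≡ w + q * (d * w)
  expand = solve-∀

count>0⇒∃ : ∀ {n} (f : Fin n → Bool) → 1 ≤ count f → ∃ λ i → f i ≡ true
count>0⇒∃ {suc n} f 1≤ with f zero in eq
... | true  = zero , eq
... | false = let i , fi = count>0⇒∃ (f ∘ suc) 1≤ in suc i , fi

∃⇒count>0 : ∀ {n} (f : Fin n → Bool) {i} → f i ≡ true → 1 ≤ count f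
∃⇒count>0 f {i} fi = subst (_≤ count f) (cong ⟦_⟧ fi) (term≤sum (⟦_⟧ ∘ f) i)

δ≤⟦⟧ : ∀ {n} (f : Fin n → Bool) {i} → f i ≡ true → ∀ j → δ i j ≤ ⟦ f j ⟧
δ≤⟦⟧ f {i} fi j with i ≟ j
... | yes refl = ≤-reflexive (sym (cong ⟦_⟧ fi))
... | no _     = z≤n

⟦⟧≤δ : ∀ {n} (f : Fin n → Bool) {i} → (∀ j → f j ≡ true → i ≡ j) → ∀ j → ⟦ f j ⟧ ≤ δ i j
⟦⟧≤δ f {i} unique j with f j in fj
... | false = z≤n
... | true  = ≤-reflexive (sym (trans (cong (δ i) (sym (unique j fj))) (δ-refl i)))

atMostOne⇒count≤1 : ∀ {n} (f : Fin n → Bool) →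
  (∀ i j → f i ≡ true → f j ≡ true → i ≡ j) → count f ≤ 1
atMostOne⇒count≤1 f unique with 1 ≤? count f
... | no ≮  = <⇒≤ (≰⇒> ≮)
... | yes 1≤ = let i , fi = count>0⇒∃ f 1≤ in
  subst (count f ≤_) (∑-δ i) (sum-mono (⟦⟧≤δ f (λ j → unique i j fi)))

-- If `i` and `j` differed, `δ i` and `δ j` would fit side by side below `f` and force a count of at
-- least 2.
count≤1⇒atMostOne : ∀ {n} (f : Fin n → Bool) → count f ≤ 1 →
  ∀ {i j} → f i ≡ true → f j ≡ true → i ≡ j
count≤1⇒atMostOne {n} f ≤1 {i} {j} fi fj with i ≟ j
... | yes i≡j = i≡j
... | no i≢j = contradiction (≤-trans 2≤ ≤1) λ { (s≤s ()) }
  where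
  both : ∀ k → δ i k + δ j k ≤ ⟦ f k ⟧
  both k with i ≟ k
  ... | no _     = δ≤⟦⟧ f fj k
  ... | yes refl = ≤-reflexive (trans (cong suc (δ-≢ (i≢j ∘ sym))) (sym (cong ⟦_⟧ fi)))
  2≤ : 2 ≤ count f
  2≤ = subst (_≤ count f)
    (trans (∑-distrib-+ (δ i) (δ j)) (cong₂ _+_ (∑-δ i) (∑-δ j))) (sum-mono both)

count≡1⇒∃! : ∀ {n} (f : Fin n → Bool) → count f ≡ 1 →
  Σ (Fin n) λ i → f i ≡ true × (∀ j → f j ≡ true → j ≡ i)
count≡1⇒∃! f eq =
  let i , fi = count>0⇒∃ f (≤-reflexive (sym eq)) in
  i , fi , λ j fj → count≤1⇒atMostOne f (≤-reflexive eq) fj fi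

∃!⇒count≡1 : ∀ {n} (f : Fin n → Bool) {i} → f i ≡ true → (∀ j → f j ≡ true → j ≡ i) → count f ≡ 1
∃!⇒count≡1 f fi unique =
  ≤-antisym (atMostOne⇒count≤1 f (λ j k fj fk → trans (unique j fj) (sym (unique k fk))))
            (∃⇒count>0 f fi)

-- The excluded `o` and `o'` may coincide, so this also serves to avoid a single point.
count>2⇒∃≢≢ : ∀ {n} (f : Fin n → Bool) → 3 ≤ count f → ∀ o o' →
  ∃ λ i → f i ≡ true × o ≢ i × o' ≢ i
count>2⇒∃≢≢ f 3≤ o o' with any? (λ i → (f i ≟ᵇ true) ×-dec ¬? (o ≟ i) ×-dec ¬? (o' ≟ i))
... | yes found = found
... | no none   = contradiction (≤-trans 3≤ count≤2) λ { (s≤s (s≤s ())) }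
  where
  bound : ∀ i → ⟦ f i ⟧ ≤ δ o i + δ o' i
  bound i with f i in fi | o ≟ i | o' ≟ i
  ... | false | _     | _      = z≤n
  ... | true  | yes _ | _      = s≤s z≤n
  ... | true  | no _  | yes _  = s≤s z≤n
  ... | true  | no o≢ | no o'≢ = contradiction (i , fi , o≢ , o'≢) none
  count≤2 : count f ≤ 2
  count≤2 = subst (count f ≤_)
    (trans (∑-distrib-+ (δ o) (δ o')) (cong₂ _+_ (∑-δ o) (∑-δ o'))) (sum-mono bound)

-- Regular incidence structures

module _ {n m} (I : Incidence n m) where

  size : Fin m → ℕ
  size X = ∑[ p < n ] ⟦ I p X ⟧

  degree : Fin n → ℕ
  degree p = ∑[ X < m ] ⟦ I p X ⟧

  -- An entry of `N Nᵀ` for the incidence matrix `N`; `meet` gives the entries of `Nᵀ N`.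
  join : Fin n → Fin n → ℕ
  join p a = ∑[ X < m ] (⟦ I p X ⟧ * ⟦ I a X ⟧)

  meet : Fin m → Fin m → ℕ
  meet X Y = ∑[ p < n ] (⟦ I p X ⟧ * ⟦ I p Y ⟧)

  join-self : ∀ p → join p p ≡ degree p
  join-self p = sum-cong-≗ (λ X → ⟦⟧-idem (I p X))

  meet-self : ∀ X → meet X X ≡ size X
  meet-self X = sum-cong-≗ (λ p → ⟦⟧-idem (I p X))

  meet-comm : ∀ X Y → meet X Y ≡ meet Y X
  meet-comm X Y = sum-cong-≗ (λ p → *-comm ⟦ I p X ⟧ ⟦ I p Y ⟧)

  join-count : ∀ p a → join p a ≡ count (λ X → I p X ∧ I a X)
  join-count p a = sum-cong-≗ (λ X → sym (⟦⟧-∧ (I p X) (I a X)))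

  meet-count : ∀ X Y → meet X Y ≡ count (λ p → I p X ∧ I p Y)
  meet-count X Y = sum-cong-≗ (λ p → sym (⟦⟧-∧ (I p X) (I p Y)))

  ∑-size-through : ∀ p → ∑[ X < m ] (⟦ I p X ⟧ * size X) ≡ ∑[ a < n ] join p a
  ∑-size-through p = ∑-swap (λ X → ⟦ I p X ⟧) (λ a X → ⟦ I a X ⟧)

  ∑-meet-through : ∀ p Y → ∑[ X < m ] (⟦ I p X ⟧ * meet X Y) ≡ ∑[ a < n ] (⟦ I a Y ⟧ * join p a)
  ∑-meet-through p Y = ∑-swap-* (λ X → ⟦ I p X ⟧) (λ a X → ⟦ I a X ⟧) (λ a → ⟦ I a Y ⟧)

  ∑-size : ∑[ X < m ] size X ≡ ∑[ p < n ] degree p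
  ∑-size = ∑-comm (λ X p → ⟦ I p X ⟧)

  twoPoints⇒join≡1 : TwoPointsOneLine I → ∀ {p a} → p ≢ a → join p a ≡ 1
  twoPoints⇒join≡1 twoPoints {p} {a} p≢a =
    let L , (pL , aL) , unique = twoPoints p a p≢a in
    trans (join-count p a) (∃!⇒count≡1 _ (true-∧ pL aL)
      (λ X pa → unique X (proj₁ (∧-true pa)) (proj₂ (∧-true pa))))

  twoPoints⇒meet≤1 : TwoPointsOneLine I → ∀ {X Y} → X ≢ Y → meet X Y ≤ 1
  twoPoints⇒meet≤1 twoPoints {X} {Y} X≢Y =
    subst (_≤ 1) (sym (meet-count X Y)) (atMostOne⇒count≤1 _ same)
    where
    same : ∀ p a → I p X ∧ I p Y ≡ true → I a X ∧ I a Y ≡ true → p ≡ a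
    same p a pXY aXY with p ≟ a
    ... | yes p≡a = p≡a
    ... | no p≢a  =
      let pX , pY = ∧-true pXY
          aX , aY = ∧-true aXY
          L , _ , unique = twoPoints p a p≢a
      in contradiction (trans (unique X pX aX) (sym (unique Y pY aY))) X≢Y

-- N Nᵀ = q · 1 + J for the incidence matrix N and the all-one matrix J.
Regular : ∀ {n m} → ℕ → Incidence n m → Set
Regular q I = ∀ p a → join I p a ≡ 1 + q * δ p a

-- Off the diagonal the entry counts joining lines, on the diagonal it is the degree. One equation
-- thus carries both properties kept during the extension, with no condition on line sizes.
regular : ∀ {n m q} (I : Incidence n m) → TwoPointsOneLine I →
  (∀ p → degree I p ≡ suc q) → Regular q I
regular {q = q} I twoPoints degrees p a with p ≟ a
... | yes refl = trans (join-self I p) (trans (degrees p) (cong suc (sym (*-identityʳ q))))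
... | no p≢a   = trans (twoPoints⇒join≡1 I twoPoints p≢a) (cong suc (sym (*-zeroʳ q)))

-- Quadratic inequalities without subtraction

am-gm-< : ∀ {a b} → a < b → 1 + 2 * (a * b) ≤ a * a + b * b
am-gm-< {a} {b} a<b with m≤n⇒∃[o]m+o≡n a<b
-- With `b = 1 + a + d` the difference of the two sides is `(b - a)² - 1 = 2d + d²`.
... | d , refl = subst (1 + 2 * (a * (1 + a + d)) ≤_) (expand a d) (m≤m+n _ _)
  where
  expand : ∀ a d → 1 + 2 * (a * (1 + a + d)) + (2 * d + d * d) ≡ a * a + (1 + a + d) * (1 + a + d)
  expand = solve-∀

am-gm-≢ : ∀ {a b} → a ≢ b → 1 + 2 * (a * b) ≤ a * a + b * b
am-gm-≢ {a} {b} a≢b with <-cmp a b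
... | tri< a<b _ _ = am-gm-< a<b
... | tri≈ _ a≡b _ = contradiction a≡b a≢b
... | tri> _ _ b<a = begin
  1 + 2 * (a * b)  ≡⟨ cong (λ x → 1 + 2 * x) (*-comm a b) ⟩
  1 + 2 * (b * a)  ≤⟨ am-gm-< b<a ⟩
  b * b + a * a    ≡⟨ +-comm (b * b) (a * a) ⟩
  a * a + b * b    ∎
  where open ≤-Reasoning

am-gm : ∀ a b → 2 * (a * b) ≤ a * a + b * b
am-gm a b with a ≟ℕ b
... | yes refl = ≤-reflexive (cong (a * a +_) (+-identityʳ (a * a)))
... | no a≢b   = <⇒≤ (am-gm-≢ a≢b)

-- Counting in regular structures

module RegularProperties {n m q} {I : Incidence n m} (reg : Regular q I) where

  degree-regular : ∀ p → degree I p ≡ suc q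
  degree-regular p = begin
    degree I p       ≡⟨ join-self I p ⟨
    join I p p       ≡⟨ reg p p ⟩
    1 + q * δ p p    ≡⟨ cong (λ d → 1 + q * d) (δ-refl p) ⟩
    1 + q * 1        ≡⟨ cong suc (*-identityʳ q) ⟩
    suc q            ∎
    where open ≡-Reasoning

  twoPointsOneLine : TwoPointsOneLine I
  twoPointsOneLine p a p≢a =
    let L , paL , unique = count≡1⇒∃! _ joined in
    L , ∧-true paL , λ X pX aX → unique X (true-∧ pX aX)
    where
    joined : count (λ X → I p X ∧ I a X) ≡ 1
    joined = trans (sym (join-count I p a))
      (trans (reg p a) (cong suc (trans (cong (q *_) (δ-≢ p≢a)) (*-zeroʳ q))))

  meet≤1 : ∀ {X Y} → X ≢ Y → meet I X Y ≤ 1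
  meet≤1 = twoPoints⇒meet≤1 I twoPointsOneLine

  ∑-weighted-join : ∀ p (w : Fin n → ℕ) → ∑[ a < n ] (w a * join I p a) ≡ sum w + q * w p
  ∑-weighted-join p w = trans (sum-cong-≗ (λ a → cong (w a *_) (reg p a))) (∑-weighted-1+qδ q p w)

  ∑-1+qδ : ∀ X → ∑[ Y < m ] (1 + q * δ X Y) ≡ m + q
  ∑-1+qδ X = begin
    ∑[ Y < m ] (1 + q * δ X Y)                ≡⟨ ∑-distrib-+ {m} (λ _ → 1) (λ Y → q * δ X Y) ⟩
    ∑[ Y < m ] 1 + ∑[ Y < m ] (q * δ X Y)     ≡⟨ cong₂ _+_ (trans (sum-const m 1) (*-identityʳ m)) (sym (*-distribˡ-sum q (δ X))) ⟩
    m + q * ∑[ Y < m ] δ X Y                  ≡⟨ cong (λ x → m + q * x) (∑-δ X) ⟩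
    m + q * 1                                 ≡⟨ cong (m +_) (*-identityʳ q) ⟩
    m + q                                     ∎
    where open ≡-Reasoning

  ∑-through-1+qδ : ∀ p X → ∑[ Y < m ] (⟦ I p Y ⟧ * (1 + q * δ X Y)) ≡ suc q + q * ⟦ I p X ⟧
  ∑-through-1+qδ p X = trans (∑-weighted-1+qδ q X (λ Y → ⟦ I p Y ⟧)) (cong (_+ q * ⟦ I p X ⟧) (degree-regular p))

  ∑-meet-through-regular : ∀ p Y → ∑[ X < m ] (⟦ I p X ⟧ * meet I X Y) ≡ size I Y + q * ⟦ I p Y ⟧
  ∑-meet-through-regular p Y = trans (∑-meet-through I p Y) (∑-weighted-join p (λ a → ⟦ I a Y ⟧))

  ∑-size-through-regular : ∀ p → ∑[ X < m ] (⟦ I p X ⟧ * size I X) ≡ n + q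
  ∑-size-through-regular p = begin
    ∑[ X < m ] (⟦ I p X ⟧ * size I X)   ≡⟨ ∑-size-through I p ⟩
    ∑[ a < n ] join I p a               ≡⟨ sum-cong-≗ (λ a → sym (*-identityˡ (join I p a))) ⟩
    ∑[ a < n ] (1 * join I p a)         ≡⟨ ∑-weighted-join p (λ _ → 1) ⟩
    ∑[ a < n ] 1 + q * 1                ≡⟨ cong₂ _+_ (trans (sum-const n 1) (*-identityʳ n)) (*-identityʳ q) ⟩
    n + q                               ∎
    where open ≡-Reasoning

  ∑-size-regular : sum (size I) ≡ n * suc q
  ∑-size-regular = trans (∑-size I) (trans (sum-cong-≗ degree-regular) (sum-const n (suc q)))

  ∑-meet-regular : ∀ X → ∑[ Y < m ] meet I X Y ≡ size I X * suc q
  ∑-meet-regular X = begin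
    ∑[ Y < m ] meet I X Y                                   ≡⟨ ∑-comm (λ Y p → ⟦ I p X ⟧ * ⟦ I p Y ⟧) ⟩
    ∑[ p < n ] ∑[ Y < m ] (⟦ I p X ⟧ * ⟦ I p Y ⟧)           ≡⟨ sum-cong-≗ (λ p → *-distribˡ-sum ⟦ I p X ⟧ (λ Y → ⟦ I p Y ⟧)) ⟨
    ∑[ p < n ] (⟦ I p X ⟧ * degree I p)                     ≡⟨ sum-cong-≗ (λ p → cong (⟦ I p X ⟧ *_) (degree-regular p)) ⟩
    ∑[ p < n ] (⟦ I p X ⟧ * suc q)                          ≡⟨ *-distribʳ-sum (suc q) (λ p → ⟦ I p X ⟧) ⟨
    size I X * suc q                                        ∎
    where open ≡-Reasoning

  ∑-size²-regular : ∑[ X < m ] (size I X * size I X) ≡ n * (n + q)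
  ∑-size²-regular = begin
    ∑[ X < m ] (size I X * size I X)                        ≡⟨ ∑-swap (size I) (λ p X → ⟦ I p X ⟧) ⟩
    ∑[ p < n ] ∑[ X < m ] (size I X * ⟦ I p X ⟧)            ≡⟨ sum-cong-≗ (λ p → sum-cong-≗ (λ X → *-comm (size I X) ⟦ I p X ⟧)) ⟩
    ∑[ p < n ] ∑[ X < m ] (⟦ I p X ⟧ * size I X)            ≡⟨ sum-cong-≗ ∑-size-through-regular ⟩
    ∑[ p < n ] (n + q)                                      ≡⟨ sum-const n (n + q) ⟩
    n * (n + q)                                             ∎
    where open ≡-Reasoning

  ∑-am-gmˡ : ∀ k → ∑[ X < m ] (2 * (k * size I X)) ≡ 2 * (k * (n * suc q))
  ∑-am-gmˡ k = begin
    ∑[ X < m ] (2 * (k * size I X))  ≡⟨ *-distribˡ-sum 2 (λ X → k * size I X) ⟨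
    2 * ∑[ X < m ] (k * size I X)    ≡⟨ cong (2 *_) (*-distribˡ-sum k (size I)) ⟨
    2 * (k * sum (size I))           ≡⟨ cong (λ x → 2 * (k * x)) ∑-size-regular ⟩
    2 * (k * (n * suc q))            ∎
    where open ≡-Reasoning

  ∑-am-gmʳ : ∀ k → ∑[ X < m ] (k * k + size I X * size I X) ≡ m * (k * k) + n * (n + q)
  ∑-am-gmʳ k = trans (∑-distrib-+ (λ _ → k * k) (λ X → size I X * size I X))
                     (cong₂ _+_ (sum-const m (k * k)) ∑-size²-regular)

  -- If no size were `q`, every `(k - q)²` would be at least 1 and their sum at least `m`. With
  -- `m = n + 1 + d` the known sums turn this into `(1 + d)(n + 1) ≤ (1 + d) q²`, contrary to
  -- `q² ≤ n`.
  size≡q-exists : q * q ≤ n → n < m → m ≡ suc (q * q + q) → ∃ λ X → size I X ≡ q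
  size≡q-exists q²≤n n<m m≡ with any? (λ X → size I X ≟ℕ q)
  ... | yes found = found
  ... | no none with m≤n⇒∃[o]m+o≡n n<m
  ... | d , refl = contradiction (begin
    suc n * suc d          ≡⟨ *-comm (suc n) (suc d) ⟩
    suc d * suc n          ≤⟨ +-cancelˡ-≤ common _ _ summed ⟩
    suc d * (q * q)        ≤⟨ *-monoʳ-≤ (suc d) q²≤n ⟩
    suc d * n              ≡⟨ *-comm (suc d) n ⟩
    n * suc d              ∎) (<⇒≱ (*-monoˡ-< (suc d) (n<1+n n)))
    where
    open ≤-Reasoning
    common : ℕ
    common = n + 2 * (q * (n * suc q))
    lhs : ∀ n q d → (n + 2 * (q * (n * suc q))) + suc d * suc n ≡ suc n + d + 2 * (q * (n * suc q)) + n * suc d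
    lhs = solve-∀
    rhs : ∀ n q d → (suc n + d) * (q * q) + n * (n + q) + n * suc d ≡ n * (suc n + d) + (suc n + d) * (q * q) + n * q
    rhs = solve-∀
    rhs′ : ∀ n q d → n * suc (q * q + q) + (suc n + d) * (q * q) + n * q ≡ (n + 2 * (q * (n * suc q))) + suc d * (q * q)
    rhs′ = solve-∀
    am-gm-summed : suc n + d + 2 * (q * (n * suc q)) ≤ (suc n + d) * (q * q) + n * (n + q)
    am-gm-summed = begin
      m + 2 * (q * (n * suc q))                  ≡⟨ cong₂ _+_ (trans (sum-const m 1) (*-identityʳ m)) (∑-am-gmˡ q) ⟨
      ∑[ X < m ] 1 + ∑[ X < m ] (2 * (q * size I X))  ≡⟨ ∑-distrib-+ (λ _ → 1) (λ X → 2 * (q * size I X)) ⟨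
      ∑[ X < m ] (1 + 2 * (q * size I X))        ≤⟨ sum-mono (λ X → am-gm-≢ (λ q≡ → none (X , sym q≡))) ⟩
      ∑[ X < m ] (q * q + size I X * size I X)   ≡⟨ ∑-am-gmʳ q ⟩
      m * (q * q) + n * (n + q)                  ∎
    summed : common + suc d * suc n ≤ common + suc d * (q * q)
    summed = begin
      common + suc d * suc n                                         ≡⟨ lhs n q d ⟩
      -- Adding `n * suc d` completes `n * n` to `n * m`, where `m≡` can be substituted; afterwards
      -- `common` cancels.
      m + 2 * (q * (n * suc q)) + n * suc d                          ≤⟨ +-monoˡ-≤ (n * suc d) am-gm-summed ⟩
      m * (q * q) + n * (n + q) + n * suc d                          ≡⟨ rhs n q d ⟩
      n * m + m * (q * q) + n * q                                    ≡⟨ cong (λ x → n * x + m * (q * q) + n * q) m≡ ⟩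
      n * suc (q * q + q) + m * (q * q) + n * q                      ≡⟨ rhs′ n q d ⟩
      common + suc d * (q * q)                                       ∎

  -- The parallel class of a line with q points

  parallelClass : Fin m → Fin m → Bool
  parallelClass X Y = does (X ≟ Y) ∨ does (meet I X Y ≟ℕ 0)

  module _ {X} (size≡q : size I X ≡ q) where

    -- Off the diagonal `meet` is 0 or 1 and membership in the class is its complement; on the
    -- diagonal `X` belongs to its own class and `meet` contributes `q`. Sums of `meet` are known,
    -- so this identity determines the counts over the class.
    parallelClass+meet : ∀ Y → ⟦ parallelClass X Y ⟧ + meet I X Y ≡ 1 + q * δ X Y
    parallelClass+meet Y with X ≟ Y
    ... | yes refl = cong suc (trans (meet-self I X) (trans size≡q (sym (*-identityʳ q))))
    ... | no X≢Y with meet I X Y | meet≤1 X≢Y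
    ...   | zero  | _       = cong suc (sym (*-zeroʳ q))
    ...   | suc zero | _    = cong suc (sym (*-zeroʳ q))
    ...   | suc (suc _) | s≤s ()

    -- Summing the identity over all lines gives `count + q(q + 1) = m + q`. The result becomes the
    -- degree of the point adjoined to the class.
    count-parallelClass : m ≡ suc (q * q + q) → count (parallelClass X) ≡ suc q
    count-parallelClass m≡ = +-cancelʳ-≡ (q * suc q) _ _ (begin
      count (parallelClass X) + q * suc q                      ≡⟨ cong (λ k → count (parallelClass X) + k * suc q) size≡q ⟨
      count (parallelClass X) + size I X * suc q               ≡⟨ cong (count (parallelClass X) +_) (∑-meet-regular X) ⟨
      count (parallelClass X) + sum (meet I X)                 ≡⟨ ∑-distrib-+ (λ Y → ⟦ parallelClass X Y ⟧) (meet I X) ⟨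
      ∑[ Y < m ] (⟦ parallelClass X Y ⟧ + meet I X Y)          ≡⟨ sum-cong-≗ parallelClass+meet ⟩
      ∑[ Y < m ] (1 + q * δ X Y)                               ≡⟨ ∑-1+qδ X ⟩
      m + q                                                    ≡⟨ cong (_+ q) m≡ ⟩
      suc (q * q + q) + q                                      ≡⟨ arith q ⟩
      suc q + q * suc q                                        ∎)
      where
      open ≡-Reasoning
      arith : ∀ q → suc (q * q + q) + q ≡ suc q + q * suc q
      arith = solve-∀

    -- Weighting the identity by the lines through `p` treats points on and off `X` together: they
    -- differ only in the term `q * ⟦ I p X ⟧`, which cancels.
    count-parallelClass-through : ∀ p → ∑[ Y < m ] (⟦ I p Y ⟧ * ⟦ parallelClass X Y ⟧) ≡ 1
    count-parallelClass-through p = +-cancelʳ-≡ (q + q * ⟦ I p X ⟧) _ _ (begin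
      through + (q + q * ⟦ I p X ⟧)                            ≡⟨ cong (λ k → through + (k + q * ⟦ I p X ⟧)) size≡q ⟨
      through + (size I X + q * ⟦ I p X ⟧)                     ≡⟨ cong (through +_) (∑-meet-through-regular p X) ⟨
      through + ∑[ Y < m ] (⟦ I p Y ⟧ * meet I Y X)            ≡⟨ ∑-distrib-+ (λ Y → ⟦ I p Y ⟧ * ⟦ parallelClass X Y ⟧) (λ Y → ⟦ I p Y ⟧ * meet I Y X) ⟨
      ∑[ Y < m ] (⟦ I p Y ⟧ * ⟦ parallelClass X Y ⟧ + ⟦ I p Y ⟧ * meet I Y X)
                                                               ≡⟨ sum-cong-≗ pointwise ⟩
      ∑[ Y < m ] (⟦ I p Y ⟧ * (1 + q * δ X Y))                 ≡⟨ ∑-through-1+qδ p X ⟩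
      suc q + q * ⟦ I p X ⟧                                    ∎)
      where
      open ≡-Reasoning
      through : ℕ
      through = ∑[ Y < m ] (⟦ I p Y ⟧ * ⟦ parallelClass X Y ⟧)
      pointwise : ∀ Y → ⟦ I p Y ⟧ * ⟦ parallelClass X Y ⟧ + ⟦ I p Y ⟧ * meet I Y X ≡ ⟦ I p Y ⟧ * (1 + q * δ X Y)
      pointwise Y = begin
        ⟦ I p Y ⟧ * ⟦ parallelClass X Y ⟧ + ⟦ I p Y ⟧ * meet I Y X   ≡⟨ *-distribˡ-+ ⟦ I p Y ⟧ ⟦ parallelClass X Y ⟧ (meet I Y X) ⟨
        ⟦ I p Y ⟧ * (⟦ parallelClass X Y ⟧ + meet I Y X)             ≡⟨ cong (λ k → ⟦ I p Y ⟧ * (⟦ parallelClass X Y ⟧ + k)) (meet-comm I Y X) ⟩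
        ⟦ I p Y ⟧ * (⟦ parallelClass X Y ⟧ + meet I X Y)             ≡⟨ cong (⟦ I p Y ⟧ *_) (parallelClass+meet Y) ⟩
        ⟦ I p Y ⟧ * (1 + q * δ X Y)                                  ∎

  -- The q + 1 lines through p have to cover the q + 1 points of X, so each of them meets X.
  module _ {X} (size≡1+q : size I X ≡ suc q) where

    meet≤1+qδ : ∀ Y → meet I X Y ≤ 1 + q * δ X Y
    meet≤1+qδ Y with X ≟ Y
    ... | yes refl = ≤-reflexive (trans (meet-self I X) (trans size≡1+q (cong suc (sym (*-identityʳ q)))))
    ... | no X≢Y   = ≤-trans (meet≤1 X≢Y) (m≤m+n 1 (q * 0))

    meet≡1+qδ : ∀ {p Y} → I p Y ≡ true → meet I X Y ≡ 1 + q * δ X Y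
    meet≡1+qδ {p} {Y} pY = begin
      meet I X Y                        ≡⟨ +-identityʳ (meet I X Y) ⟨
      1 * meet I X Y                    ≡⟨ cong (λ b → ⟦ b ⟧ * meet I X Y) pY ⟨
      ⟦ I p Y ⟧ * meet I X Y            ≡⟨ sum-≡⇒≗ (λ Z → *-monoʳ-≤ ⟦ I p Z ⟧ (meet≤1+qδ Z)) sums Y ⟩
      ⟦ I p Y ⟧ * (1 + q * δ X Y)       ≡⟨ cong (λ b → ⟦ b ⟧ * (1 + q * δ X Y)) pY ⟩
      1 * (1 + q * δ X Y)               ≡⟨ +-identityʳ (1 + q * δ X Y) ⟩
      1 + q * δ X Y                     ∎
      where
      open ≡-Reasoning
      sums : ∑[ Z < m ] (⟦ I p Z ⟧ * meet I X Z) ≡ ∑[ Z < m ] (⟦ I p Z ⟧ * (1 + q * δ X Z))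
      sums = begin
        ∑[ Z < m ] (⟦ I p Z ⟧ * meet I X Z)          ≡⟨ sum-cong-≗ (λ Z → cong (⟦ I p Z ⟧ *_) (meet-comm I X Z)) ⟩
        ∑[ Z < m ] (⟦ I p Z ⟧ * meet I Z X)          ≡⟨ ∑-meet-through-regular p X ⟩
        size I X + q * ⟦ I p X ⟧                     ≡⟨ cong (_+ q * ⟦ I p X ⟧) size≡1+q ⟩
        suc q + q * ⟦ I p X ⟧                        ≡⟨ ∑-through-1+qδ p X ⟨
        ∑[ Z < m ] (⟦ I p Z ⟧ * (1 + q * δ X Z))     ∎

    -- A line other than `X` has a point and therefore meets `X` exactly once, so the meets with `X`
    -- sum to `m + q`. Counted from the points of `X`, the sum is `(q + 1)²`.
    number-of-lines : (∀ Y → ∃ λ p → I p Y ≡ true) → m ≡ suc (q * q + q)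
    number-of-lines nonempty = +-cancelʳ-≡ q _ _ (begin
      m + q                            ≡⟨ ∑-1+qδ X ⟨
      ∑[ Y < m ] (1 + q * δ X Y)       ≡⟨ sum-cong-≗ (λ Y → meet≡1+qδ (proj₂ (nonempty Y))) ⟨
      sum (meet I X)                   ≡⟨ ∑-meet-regular X ⟩
      size I X * suc q                 ≡⟨ cong (_* suc q) size≡1+q ⟩
      suc q * suc q                    ≡⟨ arith q ⟩
      suc (q * q + q) + q              ∎)
      where
      open ≡-Reasoning
      arith : ∀ q → suc q * suc q ≡ suc (q * q + q) + q
      arith = solve-∀

-- Extension to a projective plane

adjoin : ∀ {n m} → (Fin m → Bool) → Incidence n m → Incidence (suc n) m
adjoin C I zero    = C
adjoin C I (suc p) = I p

-- Since `C` covers each old point exactly once, the new point has one joining line to each of them;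
-- the size of `C` is its degree.
adjoin-regular : ∀ {n m q} {C : Fin m → Bool} {I : Incidence n m} → Regular q I →
  count C ≡ suc q → (∀ p → ∑[ X < m ] (⟦ I p X ⟧ * ⟦ C X ⟧) ≡ 1) → Regular q (adjoin C I)
adjoin-regular {q = q} {C} reg C≡ _ zero zero =
  trans (sum-cong-≗ (λ X → ⟦⟧-idem (C X))) (trans C≡ (cong suc (sym (*-identityʳ q))))
adjoin-regular {q = q} {C} {I} reg _ through zero (suc a) =
  trans (sum-cong-≗ (λ X → *-comm ⟦ C X ⟧ ⟦ I a X ⟧)) (trans (through a) (cong suc (sym (*-zeroʳ q))))
adjoin-regular {q = q} reg _ through (suc p) zero = trans (through p) (cong suc (sym (*-zeroʳ q)))
adjoin-regular reg _ _ (suc p) (suc a) = reg p a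

module _ {n m q} {I : Incidence n m} (reg : Regular q I) (m≡ : m ≡ suc (q * q + q)) (q²≤n : q * q ≤ n) where

  -- Each new point is attached to the parallel class of a line with exactly `q` points. Such a line
  -- exists as long as there are fewer points than lines, since adding points preserves the lower
  -- bound `q * q`. New points go in front, so `s ↑ʳ_` embeds the old ones.
  extend : ∀ s → s + n ≤ m →
    Σ (Incidence (s + n) m) λ J → Regular q J × (∀ p X → J (s ↑ʳ p) X ≡ I p X)
  extend zero    _     = I , reg , λ _ _ → refl
  extend (suc s) s+n<m =
    let J , reg-J , restricts = extend s (<⇒≤ s+n<m)
        open RegularProperties {q = q} {I = J} reg-J
        X , size≡q = size≡q-exists (≤-trans q²≤n (m≤n+m n s)) s+n<m m≡
    in adjoin (parallelClass X) J
     , adjoin-regular {I = J} reg-J (count-parallelClass size≡q m≡) (count-parallelClass-through size≡q)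
     , restricts

-- Structures with as many points as lines

module Square {m q} {J : Incidence m m} (reg : Regular q J) (m≡ : m ≡ suc (q * q + q)) where
  open RegularProperties {q = q} {I = J} reg

  -- The sums of `2(q + 1)k` and of `(q + 1)² + k²` over the line sizes `k` agree, so the inequality
  -- between the terms is an equality for each line.
  size≡1+q : ∀ X → size J X ≡ suc q
  size≡1+q X with suc q ≟ℕ size J X
  ... | yes eq = sym eq
  ... | no ≢   = contradiction (≤-reflexive (sym (sum-≡⇒≗ (λ Y → am-gm (suc q) (size J Y)) sums X))) (<⇒≱ (am-gm-≢ ≢))
    where
    open ≡-Reasoning
    arith : ∀ m q → 2 * (suc q * (m * suc q)) ≡ m * (suc q * suc q) + m * (suc (q * q + q) + q)
    arith = solve-∀
    sums : ∑[ Y < m ] (2 * (suc q * size J Y)) ≡ ∑[ Y < m ] (suc q * suc q + size J Y * size J Y)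
    sums = begin
      ∑[ Y < m ] (2 * (suc q * size J Y))                  ≡⟨ ∑-am-gmˡ (suc q) ⟩
      2 * (suc q * (m * suc q))                            ≡⟨ arith m q ⟩
      m * (suc q * suc q) + m * (suc (q * q + q) + q)      ≡⟨ cong (λ k → m * (suc q * suc q) + m * (k + q)) m≡ ⟨
      m * (suc q * suc q) + m * (m + q)                    ≡⟨ ∑-am-gmʳ (suc q) ⟨
      ∑[ Y < m ] (suc q * suc q + size J Y * size J Y)     ∎

  meet≡1 : ∀ {X Y} → X ≢ Y → meet J X Y ≡ 1
  meet≡1 {X} {Y} X≢Y =
    let p , pY = count>0⇒∃ (λ p → J p Y) (subst (1 ≤_) (sym (size≡1+q Y)) (s≤s z≤n)) in
    trans (meet≡1+qδ (size≡1+q X) pY) (cong suc (trans (cong (q *_) (δ-≢ X≢Y)) (*-zeroʳ q)))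

  twoLinesOnePoint : TwoLinesOnePoint J
  twoLinesOnePoint X Y X≢Y =
    let p , pXY , unique = count≡1⇒∃! _ (trans (sym (meet-count J X Y)) (meet≡1 X≢Y)) in
    p , ∧-true pXY , λ a aX aY → unique a (true-∧ aX aY)

  module _ (2≤q : 2 ≤ q) {X Y : Fin m} (X≢Y : X ≢ Y) where

    -- Two points on `X` and two on `Y`, all different from the intersection `o`. A line through
    -- three of them contains both points chosen on `X` or both chosen on `Y`, hence is that line,
    -- and then the third point would be `o`.
    quadrangle : Σ (Fin m) λ a → Σ (Fin m) λ b → Σ (Fin m) λ c → Σ (Fin m) λ d →
      (a ≢ b × a ≢ c × a ≢ d × b ≢ c × b ≢ d × c ≢ d) ×
      (¬ Collinear3 J a b c × ¬ Collinear3 J a b d × ¬ Collinear3 J a c d × ¬ Collinear3 J b c d)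
    quadrangle =
      let o , _ , unique = twoLinesOnePoint X Y X≢Y
          a , aX , o≢a , _   = third X o o
          b , bX , o≢b , a≢b = third X o a
          c , cY , o≢c , _   = third Y o o
          d , dY , o≢d , c≢d = third Y o c
          X∌ : ∀ {p} → J p Y ≡ true → o ≢ p → J p X ≢ true
          X∌ pY o≢p pX = o≢p (sym (unique _ pX pY))
          Y∌ : ∀ {p} → J p X ≡ true → o ≢ p → J p Y ≢ true
          Y∌ pX o≢p pY = o≢p (sym (unique _ pX pY))
      in a , b , c , d
       , ( a≢b , separate X aX (X∌ cY o≢c) , separate X aX (X∌ dY o≢d)
         , separate X bX (X∌ cY o≢c) , separate X bX (X∌ dY o≢d) , c≢d)
       , ( (λ { (Z , aZ , bZ , cZ) → X∌ cY o≢c (on-line a≢b aX bX aZ bZ cZ) })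
         , (λ { (Z , aZ , bZ , dZ) → X∌ dY o≢d (on-line a≢b aX bX aZ bZ dZ) })
         , (λ { (Z , aZ , cZ , dZ) → Y∌ aX o≢a (on-line c≢d cY dY cZ dZ aZ) })
         , (λ { (Z , bZ , cZ , dZ) → Y∌ bX o≢b (on-line c≢d cY dY cZ dZ bZ) }))
      where
      third : ∀ Z o o' → ∃ λ p → J p Z ≡ true × o ≢ p × o' ≢ p
      third Z = count>2⇒∃≢≢ (λ p → J p Z) (subst (3 ≤_) (sym (size≡1+q Z)) (s≤s 2≤q))
      separate : ∀ Z {p p'} → J p Z ≡ true → J p' Z ≢ true → p ≢ p'
      separate Z pZ p'∉Z refl = p'∉Z pZ
      on-line : ∀ {p p' r Z Z'} → p ≢ p' → J p Z ≡ true → J p' Z ≡ true →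
        J p Z' ≡ true → J p' Z' ≡ true → J r Z' ≡ true → J r Z ≡ true
      on-line {p} {p'} {r} p≢p' pZ p'Z pZ' p'Z' rZ' =
        let _ , _ , unique = twoPointsOneLine p p' p≢p' in
        subst (λ L → J r L ≡ true) (trans (unique _ pZ' p'Z') (sym (unique _ pZ p'Z))) rZ'

  projectivePlane : 2 ≤ q → IsProjectivePlaneOfOrder J q
  projectivePlane 2≤q = record
    { twoPoints  = twoPointsOneLine
    ; twoLines   = twoLinesOnePoint
    ; quadrangle = let X , Y , X≢Y = twoLines m≡ 2≤q in quadrangle 2≤q X≢Y
    ; order      = λ X → trans (card≡count (λ p → J p X)) (size≡1+q X)
    }
    where
    -- Fresh `m` and `q` allow the equation to be matched; `2 ≤ q` then exposes a second line.
    twoLines : ∀ {m q} → m ≡ suc (q * q + q) → 2 ≤ q → Σ (Fin m) λ X → Σ (Fin m) λ Y → X ≢ Y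
    twoLines refl (s≤s _) = zero , suc zero , λ ()

completion : ∀ {m q} (I : Incidence (q * q) m) → Regular q I → m ≡ suc (q * q + q) → 2 ≤ q →
  Σ (Incidence (suc q + q * q) m) λ J → Regular q J × IsProjectivePlaneOfOrder J q ×
    (∀ X → size J X ≡ suc q) × (∀ p X → J (suc q ↑ʳ p) X ≡ I p X)
-- With the summands in this order `m` becomes `suc q + q * q`, which is the number of points of the
-- extension, so `J` is square by definition.
completion {m} {q} I reg m≡ 2≤q with trans m≡ (cong suc (+-comm (q * q) q))
... | refl =
  let J , reg-J , restricts = extend {q = q} {I = I} reg m≡ ≤-refl (suc q) ≤-refl
      open Square {q = q} {J = J} reg-J m≡
  in J , reg-J , projectivePlane 2≤q , size≡1+q , restricts

-- Deleting points

-- The points to delete are the first `s`, where `extend` has put the adjoined ones.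
deleted : ∀ s {n} → Fin (s + n) → Bool
deleted zero    _       = false
deleted (suc s) zero    = true
deleted (suc s) (suc x) = deleted s x

count-deleted : ∀ s {n} → count (deleted s {n}) ≡ s
count-deleted zero {n} = trans (sum-const n 0) (*-zeroʳ n)
count-deleted (suc s)  = cong suc (count-deleted s)

deleted-↑ʳ : ∀ s {n} (p : Fin n) → deleted s (s ↑ʳ p) ≡ false
deleted-↑ʳ zero    p = refl
deleted-↑ʳ (suc s) p = deleted-↑ʳ s p

remaining⇒↑ʳ : ∀ s {n} (x : Fin (s + n)) → deleted s x ≡ false → Σ (Fin n) λ p → s ↑ʳ p ≡ x
remaining⇒↑ʳ zero    x       _ = x , refl
remaining⇒↑ʳ (suc s) (suc x) r = let p , eq = remaining⇒↑ʳ s x r in p , cong suc eq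

∑-deleted+remaining : ∀ s {n} (w : Fin (s + n) → ℕ) →
  sum w ≡ ∑[ x < s + n ] (⟦ deleted s x ⟧ * w x) + ∑[ p < n ] w (s ↑ʳ p)
∑-deleted+remaining zero {n} w = cong (_+ sum w) (sym (trans (sum-const n 0) (*-zeroʳ n)))
∑-deleted+remaining (suc s) {n} w = begin
  w zero + sum (w ∘ suc)               ≡⟨ cong (w zero +_) (∑-deleted+remaining s (w ∘ suc)) ⟩
  w zero + (gone + left)               ≡⟨ +-assoc (w zero) gone left ⟨
  w zero + gone + left                 ≡⟨ cong (λ k → k + gone + left) (+-identityʳ (w zero)) ⟨
  1 * w zero + gone + left             ∎
  where
  open ≡-Reasoning
  gone left : ℕ
  gone = ∑[ x < s + n ] (⟦ deleted s x ⟧ * w (suc x))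
  left = ∑[ p < n ] w (suc (s ↑ʳ p))

-- Here `I⁺` may have more lines than `I`. By the last hypothesis the surplus lines carry at most
-- one remaining point, so they do not survive the deletion.
obtained : ∀ {n m M s} {I : Incidence n m} {I⁺ : Incidence n M} {J : Incidence (s + n) M} →
  IsLinearSpace I → (g : Fin m → Fin M) → (∀ X X' → g X ≡ g X' → X ≡ X') →
  (∀ p X → I p X ≡ I⁺ p (g X)) → (∀ p L → J (s ↑ʳ p) L ≡ I⁺ p L) →
  (∀ L {p p'} → p ≢ p' → I⁺ p L ≡ true → I⁺ p' L ≡ true → Σ (Fin m) λ X → g X ≡ L) →
  ObtainedByDeleting I J (deleted s)
obtained {s = s} {I} {I⁺} {J} linear g g-inj agrees restricts onto = record
  { f              = s ↑ʳ_
  ; g              = g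
  ; f-inj          = λ p p' → ↑ʳ-injective s p p'
  ; g-inj          = g-inj
  ; f-notDeleted   = deleted-↑ʳ s
  ; f-onto         = remaining⇒↑ʳ s
  ; g-twoRemaining = λ X →
      let p , p' , p≢p' , pX , p'X = IsLinearSpace.lineHasTwoPoints linear X in
      s ↑ʳ p , s ↑ʳ p' , p≢p' ∘ ↑ʳ-injective s p p' , (deleted-↑ʳ s p , deleted-↑ʳ s p')
      , (trans (sym (incidence p X)) pX , trans (sym (incidence p' X)) p'X)
  ; g-onto         = λ { L (x , x' , x≢x' , (rx , rx') , (xL , x'L)) → g-onto L x≢x' rx rx' xL x'L }
  ; incidence      = incidence
  }
  where
  incidence : ∀ p X → I p X ≡ J (s ↑ʳ p) (g X)
  incidence p X = trans (agrees p X) (sym (restricts p (g X)))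
  g-onto : ∀ L {x x'} → x ≢ x' → deleted s x ≡ false → deleted s x' ≡ false →
    J x L ≡ true → J x' L ≡ true → Σ _ λ X → g X ≡ L
  g-onto L {x} {x'} x≢x' rx rx' xL x'L with remaining⇒↑ʳ s x rx | remaining⇒↑ʳ s x' rx'
  ... | p , refl | p' , refl =
    onto L (x≢x' ∘ cong (s ↑ʳ_)) (trans (sym (restricts p L)) xL) (trans (sym (restricts p' L)) x'L)

-- Adjoining a line with at most one point

-- The points of the new line are given by `w`: none in case (a), one in case (b).
addLine : ∀ {n m} → (Fin n → Bool) → Incidence n m → Incidence n (suc m)
addLine w I p zero    = w p
addLine w I p (suc X) = I p X

-- A line with at most one point joins no two distinct points, so only diagonal entries change: the
-- degree of a point on it rises by one.
addLine-regular : ∀ {n m q} (w : Fin n → Bool) (I : Incidence n m) →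
  (∀ {p a} → w p ≡ true → w a ≡ true → p ≡ a) → TwoPointsOneLine I →
  (∀ p → ⟦ w p ⟧ + degree I p ≡ suc q) → Regular q (addLine w I)
addLine-regular {q = q} w I w-unique twoPoints degrees p a with p ≟ a
... | yes refl = begin
  ⟦ w p ⟧ * ⟦ w p ⟧ + join I p p    ≡⟨ cong₂ _+_ (⟦⟧-idem (w p)) (join-self I p) ⟩
  ⟦ w p ⟧ + degree I p              ≡⟨ degrees p ⟩
  suc q                             ≡⟨ cong suc (*-identityʳ q) ⟨
  1 + q * 1                         ∎
  where open ≡-Reasoning
... | no p≢a = begin
  ⟦ w p ⟧ * ⟦ w a ⟧ + join I p a    ≡⟨ cong₂ _+_ disjoint (twoPoints⇒join≡1 I twoPoints p≢a) ⟩
  1                                 ≡⟨ cong suc (*-zeroʳ q) ⟨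
  1 + q * 0                         ∎
  where
  open ≡-Reasoning
  disjoint : ⟦ w p ⟧ * ⟦ w a ⟧ ≡ 0
  disjoint with w p in wp | w a in wa
  ... | true  | true  = contradiction (w-unique wp wa) p≢a
  ... | true  | false = refl
  ... | false | _     = refl

-- Linear spaces

module LinearSpaceProperties {n m} {I : Incidence n m} (linear : IsLinearSpace I) where
  open IsLinearSpace linear

  -- The lines through `p` partition the other `n - 1` points, while `p` itself is counted once per
  -- line. The 1 on the left avoids the subtraction.
  ∑-size-through-point : ∀ p → ∑[ X < m ] (⟦ I p X ⟧ * size I X) + 1 ≡ n + degree I p
  ∑-size-through-point p = begin
    ∑[ X < m ] (⟦ I p X ⟧ * size I X) + 1        ≡⟨ cong₂ _+_ (∑-size-through I p) (sym (∑-δ p)) ⟩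
    sum (join I p) + sum (δ p)                   ≡⟨ ∑-distrib-+ (join I p) (δ p) ⟨
    ∑[ a < n ] (join I p a + δ p a)              ≡⟨ sum-cong-≗ pointwise ⟩
    ∑[ a < n ] (1 + δ p a * degree I p)          ≡⟨ ∑-distrib-+ {n} (λ _ → 1) (λ a → δ p a * degree I p) ⟩
    ∑[ a < n ] 1 + ∑[ a < n ] (δ p a * degree I p)
                                                 ≡⟨ cong₂ _+_ (trans (sum-const n 1) (*-identityʳ n)) (∑-δ-* p (λ _ → degree I p)) ⟩
    n + degree I p                               ∎
    where
    open ≡-Reasoning
    pointwise : ∀ a → join I p a + δ p a ≡ 1 + δ p a * degree I p
    pointwise a with p ≟ a
    ... | yes refl = trans (cong (_+ 1) (join-self I p)) (trans (+-comm _ 1) (cong suc (sym (+-identityʳ _))))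
    ... | no p≢a   = cong (_+ 0) (twoPoints⇒join≡1 I twoPoints p≢a)

  ∑-through-mono : ∀ p {b : Fin m → ℕ} → (∀ X → I p X ≡ true → size I X ≤ b X) →
    ∀ X → ⟦ I p X ⟧ * size I X ≤ ⟦ I p X ⟧ * b X
  ∑-through-mono p size≤ X with I p X in pX
  ... | true  = +-monoˡ-≤ 0 (size≤ X pX)
  ... | false = z≤n

  through-bound : ∀ p {k} → (∀ X → I p X ≡ true → size I X ≤ k) → n + degree I p ≤ degree I p * k + 1
  through-bound p {k} size≤ = begin
    n + degree I p                                ≡⟨ ∑-size-through-point p ⟨
    ∑[ X < m ] (⟦ I p X ⟧ * size I X) + 1         ≤⟨ +-monoˡ-≤ 1 (sum-mono (∑-through-mono p size≤)) ⟩
    ∑[ X < m ] (⟦ I p X ⟧ * k) + 1                ≡⟨ cong (_+ 1) (*-distribʳ-sum k (λ X → ⟦ I p X ⟧)) ⟨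
    degree I p * k + 1                            ∎
    where open ≤-Reasoning

  -- Each point of `X` is joined to `p` by a line, and a line through `p` meets `X` at most once.
  size≤degree : ∀ {p X} → I p X ≡ false → size I X ≤ degree I p
  size≤degree {p} {X} p∉X = begin
    size I X                                      ≤⟨ sum-mono joined ⟩
    ∑[ a < n ] (⟦ I a X ⟧ * join I p a)           ≡⟨ ∑-meet-through I p X ⟨
    ∑[ Y < m ] (⟦ I p Y ⟧ * meet I Y X)           ≤⟨ sum-mono met ⟩
    degree I p                                    ∎
    where
    open ≤-Reasoning
    joined : ∀ a → ⟦ I a X ⟧ ≤ ⟦ I a X ⟧ * join I p a
    joined a with I a X in aX | p ≟ a
    ... | false | _        = z≤n
    ... | true  | yes refl = contradiction p∉X (true≢false aX)
    ... | true  | no p≢a   = ≤-reflexive (cong (_+ 0) (sym (twoPoints⇒join≡1 I twoPoints p≢a)))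
    met : ∀ Y → ⟦ I p Y ⟧ * meet I Y X ≤ ⟦ I p Y ⟧
    met Y with I p Y in pY | Y ≟ X
    ... | false | _        = z≤n
    ... | true  | yes refl = contradiction p∉X (true≢false pY)
    ... | true  | no Y≢X   = subst (_≤ 1) (sym (+-identityʳ _)) (twoPoints⇒meet≤1 I twoPoints Y≢X)

  2≤size : ∀ X → 2 ≤ size I X
  2≤size X with 2 ≤? size I X
  ... | yes 2≤ = 2≤
  ... | no 2≰  = let p , p' , p≢p' , pX , p'X = lineHasTwoPoints X in
    contradiction (count≤1⇒atMostOne (λ p → I p X) (≤-pred (≰⇒> 2≰)) pX p'X) p≢p'

-- The three cases for a linear space on q² points

module Cases (q : ℕ) (3≤q : 3 ≤ q) {m} (I : Incidence (q * q) m) (linear : IsLinearSpace I)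
  (degree≤ : ∀ p → degree I p ≤ suc q) (size≤ : ∀ X → size I X ≤ suc q) where
  open IsLinearSpace linear
  open LinearSpaceProperties linear

  2≤q : 2 ≤ q
  2≤q = <⇒≤ 3≤q

  linesThrough≡degree : ∀ p → linesThrough I p ≡ degree I p
  linesThrough≡degree p = card≡count (I p)

  pointsOn≡size : ∀ X → pointsOn I X ≡ size I X
  pointsOn≡size X = card≡count (λ p → I p X)

  size≤q : ∀ {X} → size I X ≢ suc q → size I X ≤ q
  size≤q {X} ≢ = ≤-pred (≤∧≢⇒< (size≤ X) ≢)

  -- Common to cases (a) and (b): `w` supplies the one line missing at each point of degree `q`, and
  -- the line disappears again when the adjoined points are deleted.
  module WithAddedLine (w : Fin (q * q) → Bool) (w-unique : ∀ {p a} → w p ≡ true → w a ≡ true → p ≡ a)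
    (degrees : ∀ p → ⟦ w p ⟧ + degree I p ≡ suc q) where

    I⁺ : Incidence (q * q) (suc m)
    I⁺ = addLine w I

    I⁺-regular : Regular q I⁺
    I⁺-regular = addLine-regular w I w-unique twoPoints degrees

    remove-added : ∀ {J : Incidence (suc q + q * q) (suc m)} →
      (∀ p L → J (suc q ↑ʳ p) L ≡ I⁺ p L) → ObtainedByDeleting I J (deleted (suc q))
    remove-added restricts = obtained {s = suc q} linear suc (λ _ _ → suc-injective) (λ _ _ → refl) restricts
      λ { zero p≢p' pW p'W → contradiction (w-unique pW p'W) p≢p' ; (suc X) _ _ _ → X , refl }

  -- Case (a): affine planes

  module CaseA′ (degrees : ∀ p → degree I p ≡ suc q) (size≢1+q : ∀ X → size I X ≢ suc q) where
    I-regular : Regular q I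
    I-regular = regular I twoPoints degrees

    open RegularProperties {q = q} {I = I} I-regular

    -- The `q + 1` lines through a point have at most `q` points each, and their sizes sum to
    -- `q² + q`, so every bound is attained.
    size≡q : ∀ X → size I X ≡ q
    size≡q X = let p , _ , _ , pX , _ = lineHasTwoPoints X in through p pX
      where
      open ≡-Reasoning
      arith : ∀ q → q * q + q ≡ suc q * q
      arith = solve-∀
      through : ∀ p → I p X ≡ true → size I X ≡ q
      through p pX = begin
        size I X                  ≡⟨ +-identityʳ (size I X) ⟨
        1 * size I X              ≡⟨ cong (λ b → ⟦ b ⟧ * size I X) pX ⟨
        ⟦ I p X ⟧ * size I X      ≡⟨ sum-≡⇒≗ (∑-through-mono p (λ Y _ → size≤q (size≢1+q Y))) sums X ⟩
        ⟦ I p X ⟧ * q             ≡⟨ cong (λ b → ⟦ b ⟧ * q) pX ⟩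
        1 * q                     ≡⟨ +-identityʳ q ⟩
        q                         ∎
        where
        sums : ∑[ Y < m ] (⟦ I p Y ⟧ * size I Y) ≡ ∑[ Y < m ] (⟦ I p Y ⟧ * q)
        sums = begin
          ∑[ Y < m ] (⟦ I p Y ⟧ * size I Y)     ≡⟨ ∑-size-through-regular p ⟩
          q * q + q                             ≡⟨ arith q ⟩
          suc q * q                             ≡⟨ cong (_* q) (degrees p) ⟨
          degree I p * q                        ≡⟨ *-distribʳ-sum q (λ Y → ⟦ I p Y ⟧) ⟩
          ∑[ Y < m ] (⟦ I p Y ⟧ * q)            ∎

    m≡ : m ≡ q * q + q
    m≡ = *-cancelʳ-≡ m (q * q + q) q {{>-nonZero (<⇒≤ 2≤q)}} (begin
      m * q                  ≡⟨ sum-const m q ⟨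
      ∑[ X < m ] q           ≡⟨ sum-cong-≗ size≡q ⟨
      sum (size I)           ≡⟨ ∑-size-regular ⟩
      q * q * suc q          ≡⟨ arith q ⟩
      (q * q + q) * q        ∎)
      where
      open ≡-Reasoning
      arith : ∀ q → q * q * suc q ≡ (q * q + q) * q
      arith = solve-∀

    disjoint⇒parallel : ∀ {X Y} → (∀ r → I r X ≡ true → I r Y ≡ false) → parallelClass X Y ≡ true
    disjoint⇒parallel {X} {Y} disjoint with X ≟ Y
    ... | yes _ = refl
    ... | no _  = dec-true (meet I X Y ≟ℕ 0) (trans (sum-cong-≗ zeros) (trans (sum-const (q * q) 0) (*-zeroʳ (q * q))))
      where
      zeros : ∀ r → ⟦ I r X ⟧ * ⟦ I r Y ⟧ ≡ 0
      zeros r with I r X in rX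
      ... | false = refl
      ... | true  = cong (λ b → ⟦ b ⟧ + 0) (disjoint r rX)

    parallel⇒disjoint : ∀ {X Y} → X ≢ Y → parallelClass X Y ≡ true →
      ∀ r → I r X ≡ true → I r Y ≡ false
    parallel⇒disjoint {X} {Y} X≢Y par r rX with X ≟ Y
    ... | yes X≡Y = contradiction X≡Y X≢Y
    ... | no _ with meet I X Y in meet≡
    ...   | zero  = ¬-not λ rY → <⇒≱ (∃⇒count>0 (λ p → I p X ∧ I p Y) (true-∧ rX rY))
                      (≤-reflexive (trans (sym (meet-count I X Y)) meet≡))
    ...   | suc _ = contradiction par λ ()

    affine : IsAffinePlaneOfOrder I q
    affine = record
      { twoPoints = twoPoints
      ; parallel  = parallel
      ; triangle  = triangle
      ; order     = λ X → trans (pointsOn≡size X) (size≡q X)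
      }
      where
      parallel : ∀ p X → I p X ≡ false →
        Σ (Fin m) λ Y → (I p Y ≡ true × (∀ r → I r X ≡ true → I r Y ≡ false)) ×
          (∀ Y' → I p Y' ≡ true → (∀ r → I r X ≡ true → I r Y' ≡ false) → Y' ≡ Y)
      parallel p X p∉X =
        let Y , pY∥X , unique = count≡1⇒∃! (λ Y → I p Y ∧ parallelClass X Y)
              (trans (sum-cong-≗ (λ Y → ⟦⟧-∧ (I p Y) (parallelClass X Y)))
                     (count-parallelClass-through (size≡q X) p))
            pY , Y∥X = ∧-true pY∥X
            -- The class of `X` contains `X` itself, which is ruled out because `p` is off `X`.
            X≢Y : X ≢ Y
            X≢Y X≡Y = true≢false pY (subst (λ Z → I p Z ≡ false) X≡Y p∉X)
        in Y , (pY , parallel⇒disjoint X≢Y Y∥X)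
         , λ Y' pY' disjoint → unique Y' (true-∧ pY' (disjoint⇒parallel disjoint))

      off : ∀ X → ∃ λ c → I c X ≡ false
      off X with any? (λ c → I c X ≟ᵇ false)
      ... | yes found = found
      ... | no none   = contradiction (begin
        q * 2                   ≤⟨ *-monoʳ-≤ q 2≤q ⟩
        q * q                   ≡⟨ trans (sum-const (q * q) 1) (*-identityʳ (q * q)) ⟨
        ∑[ c < q * q ] 1        ≡⟨ sum-cong-≗ (λ c → cong ⟦_⟧ (¬-not (λ c∉X → none (c , c∉X)))) ⟨
        size I X                ≡⟨ size≡q X ⟩
        q                       ≡⟨ *-identityʳ q ⟨
        q * 1                   ∎) (<⇒≱ (*-monoʳ-< q {{>-nonZero (<⇒≤ 2≤q)}} (n<1+n 1)))
        where open ≤-Reasoning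

      X₀ : Fin m
      X₀ = fromℕ< {0} (subst (1 ≤_) (sym m≡) (≤-trans (<⇒≤ 2≤q) (m≤n+m q (q * q))))

      triangle : Σ (Fin (q * q)) λ a → Σ (Fin (q * q)) λ b → Σ (Fin (q * q)) λ c →
        (a ≢ b × a ≢ c × b ≢ c) × ¬ Collinear3 I a b c
      triangle =
        let a , b , a≢b , aX , bX = lineHasTwoPoints X₀
            c , c∉X = off X₀
            _ , _ , unique = twoPoints a b a≢b
        in a , b , c
         , (a≢b , (λ a≡c → true≢false aX (subst (λ p → I p X₀ ≡ false) (sym a≡c) c∉X))
                , (λ b≡c → true≢false bX (subst (λ p → I p X₀ ≡ false) (sym b≡c) c∉X)))
         , λ { (Z , aZ , bZ , cZ) → true≢false cZ
                 (subst (λ L → I c L ≡ false) (trans (unique X₀ aX bX) (sym (unique Z aZ bZ))) c∉X) }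

    conclusion : ObtainedFromProjectivePlane I q × CaseA I q
    conclusion =
      -- The empty added line becomes the line at infinity: all its `q + 1` points are adjoined
      -- ones.
      let J , _ , plane , _ , restricts = completion I⁺ I⁺-regular (cong suc m≡) 2≤q in
      ( _ , _ , J , plane , deleted (suc q) , trans (card≡count (deleted (suc q))) (count-deleted (suc q))
      , remove-added restricts)
      , (λ X pointsOn≡ → size≢1+q X (trans (sym (pointsOn≡size X)) pointsOn≡)) , affine , m≡
      where open WithAddedLine (λ _ → false) (λ ()) degrees

  -- Case (b): a point on at most q lines

  module CaseB′ (u : Fin (q * q)) (degree-u≤q : degree I u ≤ q) where
    -- Lines of at most `q + 1` points through `u` cover everything only if `q² ≤ dq + 1`, where `d`
    -- is the degree of `u`. If `d < q`, then `(d + 1)q ≤ q²`, and `q ≤ 1` follows.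
    degree-u≡q : degree I u ≡ q
    degree-u≡q with m≤n⇒m<n∨m≡n degree-u≤q
    ... | inj₂ eq  = eq
    ... | inj₁ d<q = contradiction (+-cancelʳ-≤ (degree I u + d * q) q 1 (begin
      q + (d + d * q)       ≡⟨ arith₁ q d ⟩
      suc d * q + d         ≤⟨ +-monoˡ-≤ d (*-monoˡ-≤ q d<q) ⟩
      q * q + d             ≤⟨ through-bound u (λ X _ → size≤ X) ⟩
      d * suc q + 1         ≡⟨ arith₂ q d ⟩
      1 + (d + d * q)       ∎)) (<⇒≱ 2≤q)
      where
      open ≤-Reasoning
      d : ℕ
      d = degree I u
      arith₁ : ∀ q d → q + (d + d * q) ≡ suc d * q + d
      arith₁ = solve-∀
      arith₂ : ∀ q d → d * suc q + 1 ≡ 1 + (d + d * q)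
      arith₂ = solve-∀

    -- Otherwise the `q` lines through `u` would have at most `q` points each, giving
    -- `q² + q ≤ q² + 1`.
    full-line : ∃ λ X → size I X ≡ suc q
    full-line with any? (λ X → size I X ≟ℕ suc q)
    ... | yes found = found
    ... | no none   = contradiction (+-cancelˡ-≤ (q * q) q 1
      (subst (λ d → q * q + d ≤ d * q + 1) degree-u≡q
        (through-bound u (λ X _ → size≤q (λ eq → none (X , eq)))))) (<⇒≱ 2≤q)

    -- A second point p of degree q would lie on every line with q + 1 points, so at most one line
    -- through u, the line L joining u and p, could have q + 1 points.
    degree≡1+q : ∀ p → p ≢ u → degree I p ≡ suc q
    degree≡1+q p p≢u with degree I p ≟ℕ suc q
    ... | yes eq = eq
    -- The sizes of the lines through `u` exceed `q` by at most one in total, on `L`. With the 1 for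
    -- `u` itself this gives `q² + q ≤ q² + 2`, which `3 ≤ q` excludes.
    ... | no ≢   = contradiction (+-cancelˡ-≤ (q * q) q 2 (begin
      q * q + q                                                     ≡⟨ cong (q * q +_) degree-u≡q ⟨
      q * q + degree I u                                            ≡⟨ ∑-size-through-point u ⟨
      ∑[ X < m ] (⟦ I u X ⟧ * size I X) + 1                         ≤⟨ +-monoˡ-≤ 1 (sum-mono bound) ⟩
      ∑[ X < m ] (⟦ I u X ⟧ * q + δ L X) + 1                        ≡⟨ cong (_+ 1) (∑-distrib-+ (λ X → ⟦ I u X ⟧ * q) (δ L)) ⟩
      ∑[ X < m ] (⟦ I u X ⟧ * q) + ∑[ X < m ] δ L X + 1             ≡⟨ cong₂ (λ x y → x + y + 1) (sym (*-distribʳ-sum q (λ X → ⟦ I u X ⟧))) (∑-δ L) ⟩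
      degree I u * q + 1 + 1                                        ≡⟨ +-assoc (degree I u * q) 1 1 ⟩
      degree I u * q + 2                                            ≡⟨ cong (λ d → d * q + 2) degree-u≡q ⟩
      q * q + 2                                                     ∎)) (<⇒≱ 3≤q)
      where
      open ≤-Reasoning
      L : Fin m
      L = proj₁ (twoPoints p u p≢u)
      degree-p<1+q : degree I p < suc q
      degree-p<1+q = ≤∧≢⇒< (degree≤ p) ≢
      bound : ∀ X → ⟦ I u X ⟧ * size I X ≤ ⟦ I u X ⟧ * q + δ L X
      bound X with I u X in uX
      ... | false = z≤n
      ... | true with size I X ≟ℕ suc q
      ...   | no ≢1+q = ≤-trans (+-monoˡ-≤ 0 (size≤q ≢1+q)) (m≤m+n _ _)
      ...   | yes eq with I p X in pX
      ...     | false = contradiction (subst (_≤ degree I p) eq (size≤degree pX)) (<⇒≱ degree-p<1+q)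
      ...     | true  = ≤-reflexive (trans (cong (_+ 0) eq) (trans (arith q)
                  (cong (q + 0 +_) (sym (trans (cong (δ L) (proj₂ (proj₂ (twoPoints p u p≢u)) X pX uX)) (δ-refl L))))))
        where
        arith : ∀ q → suc q + 0 ≡ q + 0 + 1
        arith = solve-∀

    at-u : Fin (q * q) → Bool
    at-u p = does (u ≟ p)

    at-u-true : ∀ {p} → at-u p ≡ true → u ≡ p
    at-u-true {p} eq with u ≟ p
    ... | yes u≡p = u≡p
    ... | no _    = contradiction eq λ ()

    degrees⁺ : ∀ p → ⟦ at-u p ⟧ + degree I p ≡ suc q
    degrees⁺ p with u ≟ p
    ... | yes refl = cong suc degree-u≡q
    ... | no u≢p   = degree≡1+q p (u≢p ∘ sym)

    open WithAddedLine at-u (λ u≡p u≡a → trans (sym (at-u-true u≡p)) (at-u-true u≡a)) degrees⁺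

    1+m≡ : suc m ≡ suc (q * q + q)
    1+m≡ = RegularProperties.number-of-lines {q = q} {I = I⁺} I⁺-regular
      {suc (proj₁ full-line)} (proj₂ full-line)
      -- The added line is not empty, as it contains `u`.
      λ { zero → u , dec-true (u ≟ u) refl ; (suc X) → let p , _ , _ , pX , _ = lineHasTwoPoints X in p , pX }

    module Plane (J : Incidence (suc q + q * q) (suc m)) (plane : IsProjectivePlaneOfOrder J q)
      (size≡1+q : ∀ X → size J X ≡ suc q) (restricts : ∀ p X → J (suc q ↑ʳ p) X ≡ I⁺ p X) where

      Y : Fin (suc q + q * q) → Bool
      Y = deleted (suc q)

      -- The added line `zero` is the line W of case (b). Among its `q + 1` points in the plane only
      -- `u` remains.
      Y∩W : ∑[ x < suc q + q * q ] (⟦ Y x ⟧ * ⟦ J x zero ⟧) ≡ q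
      Y∩W = +-cancelʳ-≡ 1 _ _ (begin
        Y∩W-size + 1                                            ≡⟨ cong (Y∩W-size +_) (∑-δ u) ⟨
        Y∩W-size + sum (δ u)                                    ≡⟨ cong (Y∩W-size +_) (sum-cong-≗ (λ p → cong ⟦_⟧ (restricts p zero))) ⟨
        Y∩W-size + ∑[ p < q * q ] ⟦ J (suc q ↑ʳ p) zero ⟧       ≡⟨ ∑-deleted+remaining (suc q) (λ x → ⟦ J x zero ⟧) ⟨
        size J zero                                             ≡⟨ size≡1+q zero ⟩
        suc q                                                   ≡⟨ +-comm 1 q ⟩
        q + 1                                                   ∎)
        where
        open ≡-Reasoning
        Y∩W-size : ℕ
        Y∩W-size = ∑[ x < suc q + q * q ] (⟦ Y x ⟧ * ⟦ J x zero ⟧)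

      -- Of the `q + 1` deleted points `q` lie on W; the one left over is the point `v`.
      Y∖W : count (λ x → Y x ∧ not (J x zero)) ≡ 1
      Y∖W = +-cancelˡ-≡ q _ _ (begin
        q + Y∖W-size                                            ≡⟨ cong (_+ Y∖W-size) Y∩W ⟨
        ∑[ x < suc q + q * q ] (⟦ Y x ⟧ * ⟦ J x zero ⟧) + Y∖W-size
          ≡⟨ ∑-distrib-+ (λ x → ⟦ Y x ⟧ * ⟦ J x zero ⟧) (λ x → ⟦ Y x ∧ not (J x zero) ⟧) ⟨
        ∑[ x < suc q + q * q ] (⟦ Y x ⟧ * ⟦ J x zero ⟧ + ⟦ Y x ∧ not (J x zero) ⟧)
                                                                ≡⟨ sum-cong-≗ (λ x → split (Y x) (J x zero)) ⟩
        count Y                                                 ≡⟨ count-deleted (suc q) ⟩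
        suc q                                                   ≡⟨ +-comm 1 q ⟩
        q + 1                                                   ∎)
        where
        open ≡-Reasoning
        Y∖W-size : ℕ
        Y∖W-size = count (λ x → Y x ∧ not (J x zero))
        split : ∀ a b → ⟦ a ⟧ * ⟦ b ⟧ + ⟦ a ∧ not b ⟧ ≡ ⟦ a ⟧
        split true  true  = refl
        split true  false = refl
        split false _     = refl

      ∃!v : Σ (Fin (suc q + q * q)) λ v →
        Y v ∧ not (J v zero) ≡ true × (∀ x → Y x ∧ not (J x zero) ≡ true → x ≡ v)
      ∃!v = count≡1⇒∃! (λ x → Y x ∧ not (J x zero)) Y∖W

      v : Fin (suc q + q * q)
      v = proj₁ ∃!v

      v∈Y∖W : Y v ≡ true × not (J v zero) ≡ true
      v∈Y∖W = ∧-true (proj₁ (proj₂ ∃!v))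

      Y⊆W∪v : ∀ x → Y x ≡ true → (J x zero ≡ true × x ≢ suc q ↑ʳ u) ⊎ x ≡ v
      Y⊆W∪v x x∈Y with J x zero in xW
      ... | true  = inj₁ (refl , λ x≡u →
                      true≢false x∈Y (subst (λ y → Y y ≡ false) (sym x≡u) (deleted-↑ʳ (suc q) u)))
      ... | false = inj₂ (proj₂ (proj₂ ∃!v) x (true-∧ x∈Y (cong not xW)))

      W∖u⊆Y : ∀ x → J x zero ≡ true → x ≢ suc q ↑ʳ u → Y x ≡ true
      W∖u⊆Y x xW x≢u = ¬-not λ x∉Y → kept (remaining⇒↑ʳ (suc q) x x∉Y)
        where
        kept : ¬ (Σ (Fin (q * q)) λ p → suc q ↑ʳ p ≡ x)
        kept (p , refl) = x≢u (cong (suc q ↑ʳ_) (sym (at-u-true (trans (sym (restricts p zero)) xW))))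

      conclusion : ObtainedFromProjectivePlane I q × CaseB I q
      conclusion =
        ( _ , _ , J , plane , Y , trans (card≡count Y) (count-deleted (suc q)) , remove-added restricts)
        , u , subst (_≤ q) (sym (linesThrough≡degree u)) degree-u≤q
        , ( _ , _ , J , plane , zero , suc q ↑ʳ u , v
          , trans (restricts u zero) (dec-true (u ≟ u) refl) , not-true (proj₂ v∈Y∖W)
          , Y , Y⊆W∪v , W∖u⊆Y , proj₁ v∈Y∖W
          , remove-added restricts , refl , (λ _ ())
          , λ { zero W≢W → contradiction refl W≢W ; (suc X) _ → X , refl })
        , cong pred 1+m≡ , trans (linesThrough≡degree u) degree-u≡q
        , λ p p≢u → trans (linesThrough≡degree p) (degree≡1+q p p≢u)

    conclusion : ObtainedFromProjectivePlane I q × CaseB I q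
    conclusion =
      let J , _ , plane , size≡1+q , restricts = completion I⁺ I⁺-regular 1+m≡ 2≤q
      in Plane.conclusion J plane size≡1+q restricts

  -- Case (c): all points on q + 1 lines and some line with q + 1 points

  module CaseC′ (degrees : ∀ p → degree I p ≡ suc q) {X₀} (size≡1+q : size I X₀ ≡ suc q) where
    I-regular : Regular q I
    I-regular = regular I twoPoints degrees

    m≡ : m ≡ suc (q * q + q)
    m≡ = RegularProperties.number-of-lines {q = q} {I = I} I-regular size≡1+q
      λ X → let p , _ , _ , pX , _ = lineHasTwoPoints X in p , pX

    module Plane (J : Incidence (suc q + q * q) m) (J-regular : Regular q J)
      (plane : IsProjectivePlaneOfOrder J q)
      (J-size : ∀ X → size J X ≡ suc q) (restricts : ∀ p X → J (suc q ↑ʳ p) X ≡ I p X) where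

      Y : Fin (suc q + q * q) → Bool
      Y = deleted (suc q)

      Y∩ : Fin m → ℕ
      Y∩ L = ∑[ x < suc q + q * q ] (⟦ J x L ⟧ * ⟦ Y x ⟧)

      Y∩+size : ∀ L → Y∩ L + size I L ≡ suc q
      Y∩+size L = begin
        Y∩ L + size I L       ≡⟨ cong₂ _+_ (sum-cong-≗ (λ x → *-comm ⟦ J x L ⟧ ⟦ Y x ⟧))
                                           (sum-cong-≗ (λ p → cong ⟦_⟧ (sym (restricts p L)))) ⟩
        ∑[ x < suc q + q * q ] (⟦ Y x ⟧ * ⟦ J x L ⟧) + ∑[ p < q * q ] ⟦ J (suc q ↑ʳ p) L ⟧
                              ≡⟨ ∑-deleted+remaining (suc q) (λ x → ⟦ J x L ⟧) ⟨
        size J L              ≡⟨ J-size L ⟩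
        suc q                 ∎
        where open ≡-Reasoning

      card≡Y∩ : ∀ L → card (λ x → Y x ∧ J x L) ≡ Y∩ L
      card≡Y∩ L = trans (card≡count (λ x → Y x ∧ J x L))
        (sum-cong-≗ (λ x → trans (⟦⟧-∧ (Y x) (J x L)) (*-comm ⟦ Y x ⟧ ⟦ J x L ⟧)))

      -- Every line of the plane is a line of the linear space and so keeps at least two of its
      -- `q + 1` points.
      Y∩<q : ∀ L → Y∩ L < q
      Y∩<q L = ≤-pred (begin
        2 + Y∩ L              ≡⟨ +-comm 2 (Y∩ L) ⟩
        Y∩ L + 2              ≤⟨ +-monoʳ-≤ (Y∩ L) (2≤size L) ⟩
        Y∩ L + size I L       ≡⟨ Y∩+size L ⟩
        suc q                 ∎)
        where open ≤-Reasoning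

      -- Only q points of Y other than y are available for the q + 1 lines through y.
      tangent : ∀ y → Y y ≡ true → ∃ λ X → J y X ≡ true × size I X ≡ q
      tangent y y∈Y with any? (λ X → (J y X ≟ᵇ true) ×-dec (size I X ≟ℕ q))
      ... | yes found = found
      ... | no none   = contradiction (begin
        suc q + suc q                                           ≡⟨ double (suc q) ⟩
        suc q * 2                                               ≡⟨ cong (_* 2) (RegularProperties.degree-regular {q = q} {I = J} J-regular y) ⟨
        degree J y * 2                                          ≡⟨ *-distribʳ-sum 2 (λ X → ⟦ J y X ⟧) ⟩
        ∑[ X < m ] (⟦ J y X ⟧ * 2)                              ≤⟨ sum-mono secant ⟩
        ∑[ X < m ] (⟦ J y X ⟧ * Y∩ X)                           ≡⟨ ∑-swap-* (λ X → ⟦ J y X ⟧) (λ x X → ⟦ J x X ⟧) (λ x → ⟦ Y x ⟧) ⟩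
        ∑[ x < suc q + q * q ] (⟦ Y x ⟧ * join J y x)           ≡⟨ RegularProperties.∑-weighted-join {q = q} {I = J} J-regular y (λ x → ⟦ Y x ⟧) ⟩
        count Y + q * ⟦ Y y ⟧                                   ≡⟨ cong₂ (λ c b → c + q * ⟦ b ⟧) (count-deleted (suc q)) y∈Y ⟩
        suc q + q * 1                                           ≡⟨ cong (suc q +_) (*-identityʳ q) ⟩
        suc q + q                                               ∎) (<⇒≱ (+-monoʳ-< (suc q) (n<1+n q)))
        where
        open ≤-Reasoning
        double : ∀ k → k + k ≡ k * 2
        double = solve-∀
        2≤Y∩ : ∀ X → J y X ≡ true → 2 ≤ Y∩ X
        -- The point `y` contributes 1. If no other deleted point were on `X`, then `q` points of
        -- `X` would remain, contrary to `none`.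
        2≤Y∩ X yX = ≤∧≢⇒<
          (subst (_≤ Y∩ X) (cong₂ (λ a b → ⟦ a ⟧ * ⟦ b ⟧) yX y∈Y) (term≤sum (λ x → ⟦ J x X ⟧ * ⟦ Y x ⟧) y))
          (λ 1≡ → none (X , yX , cong pred (trans (cong (_+ size I X) 1≡) (Y∩+size X))))
        secant : ∀ X → ⟦ J y X ⟧ * 2 ≤ ⟦ J y X ⟧ * Y∩ X
        secant X with J y X in yX
        ... | true  = +-monoˡ-≤ 0 (2≤Y∩ X yX)
        ... | false = z≤n

      deletion : ObtainedByDeleting I J Y
      deletion = obtained {s = suc q} linear id (λ _ _ → id) (λ _ _ → refl) restricts (λ L _ _ _ → L , refl)

      conclusion : ObtainedFromProjectivePlane I q × CaseC I q
      conclusion =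
        (_ , _ , J , plane , Y , card-Y , deletion)
        , trans m≡ (+-comm 1 (q * q + q)) , (λ p → trans (linesThrough≡degree p) (degrees p))
        , _ , _ , J , plane , Y , card-Y , (λ L → subst (_< q) (sym (card≡Y∩ L)) (Y∩<q L))
        , deletion , (λ L → L , refl)
        , λ y y∈Y → let X , yX , size≡q = tangent y y∈Y in X , yX , trans (pointsOn≡size X) size≡q
        where
        card-Y : card Y ≡ suc q
        card-Y = trans (card≡count Y) (count-deleted (suc q))

    conclusion : ObtainedFromProjectivePlane I q × CaseC I q
    conclusion =
      let J , J-regular , plane , J-size , restricts = completion I I-regular m≡ 2≤q
      in Plane.conclusion J J-regular plane J-size restricts

-- The choice between the three cases

theorem1p7 : (n m : ℕ) (I : Incidence n m) → IsLinearSpace I →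
    (q : ℕ) → 3 ≤ q → n ≡ q * q →
    ((p : Fin n) → linesThrough I p ≤ suc q) →
    ((X : Fin m) → pointsOn I X ≤ suc q) →
    ObtainedFromProjectivePlane I q × (CaseA I q ⊎ CaseB I q ⊎ CaseC I q)
theorem1p7 n m I linear q 3≤q refl linesThrough≤ pointsOn≤ = cases
  where
  degree≤ : ∀ p → degree I p ≤ suc q
  degree≤ p = subst (_≤ suc q) (card≡count (I p)) (linesThrough≤ p)
  open Cases q 3≤q I linear degree≤ (λ X → subst (_≤ suc q) (card≡count (λ p → I p X)) (pointsOn≤ X))
  cases : ObtainedFromProjectivePlane I q × (CaseA I q ⊎ CaseB I q ⊎ CaseC I q)
  -- The degree test takes precedence, since a space with a point on `q` lines also has a line with
  -- `q + 1` points.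
  cases with any? (λ p → degree I p ≤? q) | any? (λ X → size I X ≟ℕ suc q)
  ... | yes (u , degree-u≤q) | _ = map₂ (inj₂ ∘ inj₁) (CaseB′.conclusion u degree-u≤q)
  ... | no none | full? = full-line? full?
    where
    degrees : ∀ p → degree I p ≡ suc q
    degrees p = ≤-antisym (degree≤ p) (≰⇒> (λ ≤q → none (p , ≤q)))
    full-line? : Dec (∃ λ X → size I X ≡ suc q) →
      ObtainedFromProjectivePlane I q × (CaseA I q ⊎ CaseB I q ⊎ CaseC I q)
    full-line? (yes (X₀ , size≡1+q)) = map₂ (inj₂ ∘ inj₂) (CaseC′.conclusion degrees size≡1+q)
    full-line? (no no-full)          = map₂ inj₁ (CaseA′.conclusion degrees (λ X eq → no-full (X , eq)))
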